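{- Let $G_1$ and $G_2$ be finite simple graphs on the vertex set $[d]=\{1,\ldots,d\}$. The following conditions are equivalent: (i) The lattice polytope $\Omega(\mathcal{Q}_{G_1},\mathcal{Q}_{G_2})$ possesses the integer decomposition property; (ii) The lattice polytope $\Omega(\mathcal{Q}_{G_1},\mathcal{Q}_{G_2})$ is reflexive and possesses the integer decomposition property; (iii) Both $G_1$ and $G_2$ are perfect.
   Context: A subset $W\subset[d]$ is stable in a graph $G$ on $[d]$ if no two distinct elements of $W$ are joined by an edge of $G$; $\emptyset$ and all singletons are stable. For $W\subset[d]$ let $\rho(W)=\sum_{j\in W}\mathbf{e}_j\in\mathbb{R}^d$ (so $\rho(\emptyset)=\mathbf{0}$), where $\mathbf{e}_1,\ldots,\mathbf{e}_d$ are the standard unit vectors. The stable set polytope $\mathcal{Q}_G\subset\mathbb{R}^d$ is the convex hull of $\{\rho(W): W \text{ stable in } G\}$. For $d$-dimensional lattice polytopes $\mathcal{P},\mathcal{Q}\subset\mathbb{R}^d$, $\Omega(\mathcal{P},\mathcal{Q})=\mathrm{conv}\{(\mathcal{P}\times\{1\})\cup(-\mathcal{Q}\times\{ -1\})\}\subset\mathbb{R}^{d+1}$. A graph $G$ is perfect if for every induced subgraph $H$ (including $G$ itself) the chromatic number of $H$ equals the maximum cardinality of a clique of $H$. A lattice polytope $\mathcal{P}\subset\mathbb{R}^N$ of dimension $N$ is reflexive if the origin lies in its interior and the dual polytope $\{\mathbf{x}: \langle\mathbf{x},\mathbf{y}\rangle\le 1\ \forall \mathbf{y}\in\mathcal{P}\}$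 is a lattice polytope. $\mathcal{P}$ has the integer decomposition property if for every integer $n\ge1$ and every $\mathbf{a}\in n\mathcal{P}\cap\mathbb{Z}^N$ there exist $\mathbf{a}_1,\ldots,\mathbf{a}_n\in\mathcal{P}\cap\mathbb{Z}^N$ with $\mathbf{a}=\mathbf{a}_1+\cdots+\mathbf{a}_n$. -}

module Defs where

open import Data.Nat as ℕ using (ℕ; zero; suc)
open import Data.Integer as ℤ using (ℤ; +_)
open import Data.Rational as ℚ using (ℚ; 0ℚ; 1ℚ)
open import Data.Bool using (Bool; true; false; if_then_else_)
open import Data.Fin using (Fin)
open import Data.Fin.Subset using (Subset; _∈_; _⊆_; ∣_∣)
open import Data.Vec using (Vec; []; _∷_; _∷ʳ_; map; zipWith; replicate; foldr; lookup)
open import Data.Vec.Relation.Unary.All using (All)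
open import Data.Product using (Σ; ∃; ∃-syntax; _×_)
open import Data.Sum using (_⊎_)
open import Relation.Binary.PropositionalEquality using (_≡_; _≢_)
open import Relation.Nullary using (¬_)
open import Function.Bundles using (_⇔_)

record SimpleGraph (d : ℕ) : Set where
  field
    E      : Fin d → Fin d → Bool
    sym    : ∀ i j → E i j ≡ E j i
    irrefl : ∀ i → E i i ≡ false
open SimpleGraph public

Stable : ∀ {d} → SimpleGraph d → Subset d → Set
Stable G W = ∀ i j → i ∈ W → j ∈ W → i ≢ j → E G i j ≡ false

Clique : ∀ {d} → SimpleGraph d → Subset d → Set
Clique G C = ∀ i j → i ∈ C → j ∈ C → i ≢ j → E G i j ≡ true

Colouring : ∀ {d} → SimpleGraph d → Subset d → ℕ → Set
Colouring {d} G S k =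
  Σ ((i : Fin d) → i ∈ S → Fin k) λ c →
    ∀ i j (i∈S : i ∈ S) (j∈S : j ∈ S) → E G i j ≡ true → c i i∈S ≢ c j j∈S

IsChromaticNumber : ∀ {d} → SimpleGraph d → Subset d → ℕ → Set
IsChromaticNumber G S k = Colouring G S k × (∀ m → Colouring G S m → k ℕ.≤ m)

IsCliqueNumber : ∀ {d} → SimpleGraph d → Subset d → ℕ → Set
IsCliqueNumber G S k =
  (∃[ C ] (C ⊆ S × Clique G C × ∣ C ∣ ≡ k)) ×
  (∀ C → C ⊆ S → Clique G C → ∣ C ∣ ℕ.≤ k)

Perfect : ∀ {d} → SimpleGraph d → Set
Perfect G = ∀ S χ ω → IsChromaticNumber G S χ → IsCliqueNumber G S ω → χ ≡ ω

toℚ : ∀ {N} → Vec ℤ N → Vec ℚ N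
toℚ = map (λ z → z ℚ./ 1)

_+ᵛ_ : ∀ {N} → Vec ℚ N → Vec ℚ N → Vec ℚ N
_+ᵛ_ = zipWith ℚ._+_

_·ᵛ_ : ∀ {N} → ℚ → Vec ℚ N → Vec ℚ N
q ·ᵛ v = map (q ℚ.*_) v

0ᵛ : ∀ {N} → Vec ℚ N
0ᵛ = replicate _ 0ℚ

dot : ∀ {N} → Vec ℚ N → Vec ℚ N → ℚ
dot x y = foldr _ ℚ._+_ 0ℚ (zipWith ℚ._*_ x y)

combo : ∀ {N k} → Vec ℚ k → Vec (Vec ℤ N) k → Vec ℚ N
combo [] [] = 0ᵛ
combo (l ∷ ls) (p ∷ ps) = (l ·ᵛ toℚ p) +ᵛ combo ls ps

InConv : ∀ {N} → (Vec ℤ N → Set) → Vec ℚ N → Set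
InConv {N} V x =
  ∃[ k ] Σ (Vec (Vec ℤ N) k) λ ps → Σ (Vec ℚ k) λ ls →
    All V ps × All (0ℚ ℚ.≤_) ls × foldr _ ℚ._+_ 0ℚ ls ≡ 1ℚ × x ≡ combo ls ps

LatticePt : ∀ {N} → (Vec ℤ N → Set) → Vec ℤ N → Set
LatticePt V p = InConv V (toℚ p)

IDP : ∀ {N} → (Vec ℤ N → Set) → Set
IDP {N} V = ∀ (n : ℕ) .{{_ : ℕ.NonZero n}} (a : Vec ℤ N) →
  InConv V (map (λ z → z ℚ./ n) a) →      -- a ∈ nP ∩ ℤ^N
  Σ (Vec (Vec ℤ N) n) λ as → All (LatticePt V) as × a ≡ foldr _ (zipWith ℤ._+_) (replicate _ (+ 0)) as

InDual : ∀ {N} → (Vec ℤ N → Set) → Vec ℚ N → Set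
InDual V x = ∀ y → InConv V y → dot x y ℚ.≤ 1ℚ

OriginInterior : ∀ {N} → (Vec ℤ N → Set) → Set
OriginInterior {N} V = ∃[ ε ] (0ℚ ℚ.< ε × (∀ (x : Vec ℚ N) → All (λ xi → ℚ.∣ xi ∣ ℚ.≤ ε) x → InConv V x))

Reflexive : ∀ {N} → (Vec ℤ N → Set) → Set
Reflexive {N} V = OriginInterior V ×
  (∃[ k ] Σ (Vec (Vec ℤ N) k) λ ws → ∀ x → InDual V x ⇔ InConv (λ w → w ∈ᵥ ws) x)
  where
  open import Data.Vec.Membership.Propositional renaming (_∈_ to _∈ᵥ_)

ρ : ∀ {d} → Subset d → Vec ℤ d
ρ = map (λ b → if b then + 1 else + 0)

ΩGen : ∀ {d} → SimpleGraph d → SimpleGraph d → Vec ℤ (suc d) → Set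
ΩGen G₁ G₂ p =
  (∃[ W ] (Stable G₁ W × p ≡ ρ W ∷ʳ + 1)) ⊎
  (∃[ W ] (Stable G₂ W × p ≡ map ℤ.-_ (ρ W) ∷ʳ ℤ.- (+ 1)))

{-# OPTIONS --safe #-}
-- Both directions rest on one inequality for weights, χ(w) ≤ ω(w).
--
-- If G₁ and G₂ are perfect, then it holds for all weights (Lovász's replication lemma), and so does its
-- dual, with cliques and stable sets exchanged. Hence Ω is cut out by 2 x(C) − h ≤ 1 for the cliques C
-- of G₁ and h − 2 x(C) ≤ 1 for those of G₂: an integral (x , h) ∈ nΩ has x⁺ covered by ⌊(n + h)/2⌋ stable
-- sets of G₁ and x⁻ by ⌊(n − h)/2⌋ stable sets of G₂, which is the decomposition property (with the origin
-- added when n + h is odd). The dual inequality shows that the polar of Ω is the hull of the integral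
-- points (2 ρ(C) , −1) and (−2 ρ(C) , 1).
--
-- Conversely, if a weight 2w is a sum of 2k + 1 stable sets of G₁, then (w , k) ∈ (k + 1)Ω. The only
-- lattice point of Ω at height 0 is the origin, so the decomposition property makes w a sum of k stable
-- sets. Iterating, a weight whose multiple Nw is a sum of fewer than Nk stable sets is a sum of k − 1.
-- If every S − v has chromatic and clique number at most k, with k + 1 < |S| = n, then (n − 1) S is a sum of
-- nk < (n − 1)(k + 1) stable sets, so that k colours suffice for S too; otherwise S is a clique, or
-- |S| − 1 colours suffice. Perfection follows by induction on |S|, without the strong perfect graph theorem.
module Submission where

open import Defs renaming (sym to E-sym)
import Algebra.Properties.CommutativeSemigroup as CommutativeSemigroupProperties
import Algebra.Properties.Group as GroupProperties
open import Algebra.Bundles using (CommutativeMonoid)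
open import Data.Bool using (Bool; true; false; if_then_else_)
open import Data.Bool.Properties using () renaming (_≟_ to _≟ᵇ_)
open import Data.Fin using (Fin; zero; suc; punchOut)
import Data.Fin.Properties as Fin
open import Data.Fin.Subset using (Subset; _∈_; _∉_; _⊆_; _∩_; _∪_; ∁; ⁅_⁆; ∣_∣; ⊤) renaming (⊥ to ∅)
open import Data.Fin.Subset.Properties
open import Data.Integer as ℤ using (ℤ; +_; -[1+_])
import Data.Integer.Properties as ℤ
open import Data.Integer.Tactic.RingSolver using () renaming (solve-∀ to solveℤ)
open import Data.List as List using (List; []; _∷_; _++_; length)
open import Data.List.Membership.Propositional using () renaming (_∈_ to _∈ˡ_)
import Data.List.Membership.Propositional.Properties as ∈ˡ
open import Data.List.Properties using (length-++; length-map)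
open import Data.List.Relation.Unary.All as All using (All; []; _∷_)
import Data.List.Relation.Unary.All.Properties as All
open import Data.List.Relation.Unary.Any using (here; there)
open import Data.Nat
open import Data.Nat.Properties
open import Data.Nat.Tactic.RingSolver using (solve-∀)
open import Data.Product using (_×_; _,_; ∃; ∃₂; ∃-syntax; proj₁; proj₂)
open import Data.Rational as ℚ using (ℚ; 0ℚ; 1ℚ)
import Data.Rational.Properties as ℚ
open import Data.Rational.Unnormalised as ℚᵘ using (mkℚᵘ; *≡*; *≤*)
import Data.Rational.Unnormalised.Properties as ℚᵘ
open import Data.Sum using (_⊎_; inj₁; inj₂; [_,_]′)
open import Data.Vec as Vec using (Vec; []; _∷_; _∷ʳ_; lookup; zipWith; map)
import Data.Vec.Membership.Propositional.Properties as ∈ᵛ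
import Data.Vec.Properties as Vec
import Data.Vec.Relation.Unary.All as Vecᴬ
import Data.Vec.Relation.Unary.All.Properties as Vecᴬ
open import Function using (_∘_; id)
open import Function.Bundles using (_⇔_; mk⇔)
open import Relation.Binary.PropositionalEquality hiding ([_])
open import Relation.Nullary using (Dec; yes; no; ¬_; contradiction; _×-dec_; _→-dec_; ¬?; does)
open import Relation.Nullary.Decidable using (map′; decidable-stable; dec-true)
open import Relation.Unary using (Decidable)

open CommutativeSemigroupProperties +-commutativeSemigroup using () renaming (interchange to +-interchange)

private variable
  d N k m n : ℕ

-- Weights on the vertex set

Weight : ℕ → Set
Weight = Vec ℕ

𝟎 : Weight d
𝟎 = Vec.replicate _ 0

infixl 6 _⊕_
_⊕_ : Weight d → Weight d → Weight d
_⊕_ = zipWith _+_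

𝟙 : Subset d → Weight d
𝟙 = map (λ b → if b then 1 else 0)

⟪_,_⟫ : Weight d → Weight d → ℕ
⟪ [] , [] ⟫       = 0
⟪ m ∷ u , n ∷ v ⟫ = m * n + ⟪ u , v ⟫

total : List (Subset d) → Weight d
total []       = 𝟎
total (W ∷ Ws) = 𝟙 W ⊕ total Ws

⊕-comm : (u v : Weight d) → u ⊕ v ≡ v ⊕ u
⊕-comm = Vec.zipWith-comm +-comm

⊕-assoc : (u v w : Weight d) → u ⊕ v ⊕ w ≡ u ⊕ (v ⊕ w)
⊕-assoc = Vec.zipWith-assoc +-assoc

⊕-identityˡ : (u : Weight d) → 𝟎 ⊕ u ≡ u
⊕-identityˡ = Vec.zipWith-identityˡ +-identityˡ

⊕-identityʳ : (u : Weight d) → u ⊕ 𝟎 ≡ u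
⊕-identityʳ = Vec.zipWith-identityʳ +-identityʳ

⊕-swap : (u v w : Weight d) → u ⊕ (v ⊕ w) ≡ v ⊕ (u ⊕ w)
⊕-swap u v w = trans (sym (⊕-assoc u v w)) (trans (cong (_⊕ w) (⊕-comm u v)) (⊕-assoc v u w))

⊕-cancelˡ : (u : Weight d) {v w : Weight d} → u ⊕ v ≡ u ⊕ w → v ≡ w
⊕-cancelˡ []      {[]}    {[]}    _  = refl
⊕-cancelˡ (m ∷ u) {_ ∷ _} {_ ∷ _} eq =
  cong₂ _∷_ (+-cancelˡ-≡ m _ _ (Vec.∷-injectiveˡ eq)) (⊕-cancelˡ u (Vec.∷-injectiveʳ eq))

lookup-⊕ : (u v : Weight d) (i : Fin d) → lookup (u ⊕ v) i ≡ lookup u i + lookup v i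
lookup-⊕ u v i = Vec.lookup-zipWith _+_ i u v

dot-comm : (u v : Weight d) → ⟪ u , v ⟫ ≡ ⟪ v , u ⟫
dot-comm []      []      = refl
dot-comm (m ∷ u) (n ∷ v) = cong₂ _+_ (*-comm m n) (dot-comm u v)

dot-⊕ˡ : (u v x : Weight d) → ⟪ u ⊕ v , x ⟫ ≡ ⟪ u , x ⟫ + ⟪ v , x ⟫
dot-⊕ˡ []      []      []      = refl
dot-⊕ˡ (m ∷ u) (n ∷ v) (k ∷ x) =
  trans (cong₂ _+_ (*-distribʳ-+ k m n) (dot-⊕ˡ u v x)) (+-interchange (m * k) (n * k) _ _)

dot-⊕ʳ : (x u v : Weight d) → ⟪ x , u ⊕ v ⟫ ≡ ⟪ x , u ⟫ + ⟪ x , v ⟫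
dot-⊕ʳ x u v = trans (dot-comm x _) (trans (dot-⊕ˡ u v x) (cong₂ _+_ (dot-comm u x) (dot-comm v x)))

dot-𝟎ˡ : (x : Weight d) → ⟪ 𝟎 , x ⟫ ≡ 0
dot-𝟎ˡ []      = refl
dot-𝟎ˡ (_ ∷ x) = dot-𝟎ˡ x

dot-𝟎ʳ : (x : Weight d) → ⟪ x , 𝟎 ⟫ ≡ 0
dot-𝟎ʳ x = trans (dot-comm x 𝟎) (dot-𝟎ˡ x)

dot-⊕ˡ-≤ : (u v x : Weight d) → ⟪ v , x ⟫ ≤ ⟪ u ⊕ v , x ⟫
dot-⊕ˡ-≤ u v x = subst (⟪ v , x ⟫ ≤_) (sym (dot-⊕ˡ u v x)) (m≤n+m _ _)

⁅⁆⊆ : {S : Subset d} {v : Fin d} → v ∈ S → ⁅ v ⁆ ⊆ S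
⁅⁆⊆ {S = S} {v} v∈S i∈ = subst (_∈ S) (sym (x∈⁅y⁆⇒x≡y v i∈)) v∈S

𝟙-∈ : {S : Subset d} {i : Fin d} → i ∈ S → lookup (𝟙 S) i ≡ 1
𝟙-∈ {S = true ∷ S}  {zero}  _   = refl
𝟙-∈ {S = false ∷ S} {zero}  ()
𝟙-∈ {S = true ∷ S}  {suc i} i∈S = 𝟙-∈ (drop-there i∈S)
𝟙-∈ {S = false ∷ S} {suc i} i∈S = 𝟙-∈ (drop-there i∈S)

𝟙-∉ : {S : Subset d} {i : Fin d} → i ∉ S → lookup (𝟙 S) i ≡ 0
𝟙-∉ {S = true ∷ S}  {zero}  i∉S = contradiction Vec.here i∉S
𝟙-∉ {S = false ∷ S} {zero}  i∉S = refl
𝟙-∉ {S = true ∷ S}  {suc i} i∉S = 𝟙-∉ (drop-not-there i∉S)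
𝟙-∉ {S = false ∷ S} {suc i} i∉S = 𝟙-∉ (drop-not-there i∉S)

lookup-ext : {A : Set} {u v : Vec A d} → (∀ i → lookup u i ≡ lookup v i) → u ≡ v
lookup-ext {u = u} {v} eq =
  trans (sym (Vec.tabulate∘lookup u)) (trans (Vec.tabulate-cong eq) (Vec.tabulate∘lookup v))

𝟙-∅ : 𝟙 {d} ∅ ≡ 𝟎
𝟙-∅ {zero}  = refl
𝟙-∅ {suc d} = cong (0 ∷_) 𝟙-∅

subtract-𝟙 : (S : Subset d) (w : Weight d) → (∀ i → i ∈ S → 1 ≤ lookup w i) → ∃[ w′ ] w ≡ 𝟙 S ⊕ w′
subtract-𝟙 []          []          _   = [] , refl
subtract-𝟙 (true ∷ S)  (zero ∷ w)  pos = contradiction (pos zero Vec.here) λ()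
subtract-𝟙 (true ∷ S)  (suc n ∷ w) pos =
  let w′ , eq = subtract-𝟙 S w (λ i → pos (suc i) ∘ Vec.there) in n ∷ w′ , cong (suc n ∷_) eq
subtract-𝟙 (false ∷ S) (n ∷ w)     pos =
  let w′ , eq = subtract-𝟙 S w (λ i → pos (suc i) ∘ Vec.there) in n ∷ w′ , cong (n ∷_) eq

𝟙-mono : {S T : Subset d} → S ⊆ T → ∃[ w ] 𝟙 T ≡ 𝟙 S ⊕ w
𝟙-mono {S = S} {T} S⊆T = subtract-𝟙 S (𝟙 T) λ _ i∈S → ≤-reflexive (sym (𝟙-∈ (S⊆T i∈S)))

dot-⊆ˡ : {S T : Subset d} (x : Weight d) → S ⊆ T → ⟪ 𝟙 S , x ⟫ ≤ ⟪ 𝟙 T , x ⟫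
dot-⊆ˡ {S = S} x S⊆T with 𝟙-mono S⊆T
... | w , eq = subst (λ v → _ ≤ ⟪ v , x ⟫) (sym eq) (subst (_ ≤_) (sym (dot-⊕ˡ (𝟙 S) w x)) (m≤m+n _ _))

lookup≤dot : (w : Weight d) {S : Subset d} {i : Fin d} → i ∈ S → lookup w i ≤ ⟪ w , 𝟙 S ⟫
lookup≤dot (n ∷ w) Vec.here = ≤-trans (≤-reflexive (sym (*-identityʳ n))) (m≤m+n (n * 1) _)
lookup≤dot (n ∷ w) {true ∷ _}  (Vec.there i∈S) = ≤-trans (lookup≤dot w i∈S) (m≤n+m _ (n * 1))
lookup≤dot (n ∷ w) {false ∷ _} (Vec.there i∈S) = ≤-trans (lookup≤dot w i∈S) (m≤n+m _ (n * 0))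

-- Both sides count the triple intersection of `C`, `S` and `W`. This moves a restriction to the
-- support from the clique to the stable set.
dot-𝟙-∩ : (C S W : Subset d) → ⟪ 𝟙 (C ∩ S) , 𝟙 W ⟫ ≡ ⟪ 𝟙 C , 𝟙 (W ∩ S) ⟫
dot-𝟙-∩ []          []          []          = refl
dot-𝟙-∩ (true ∷ C)  (true ∷ S)  (true ∷ W)  = cong suc (dot-𝟙-∩ C S W)
dot-𝟙-∩ (true ∷ C)  (true ∷ S)  (false ∷ W) = dot-𝟙-∩ C S W
dot-𝟙-∩ (true ∷ C)  (false ∷ S) (true ∷ W)  = dot-𝟙-∩ C S W
dot-𝟙-∩ (true ∷ C)  (false ∷ S) (false ∷ W) = dot-𝟙-∩ C S W
dot-𝟙-∩ (false ∷ C) (s ∷ S)     (t ∷ W)     = dot-𝟙-∩ C S W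

dot-𝟙-𝟙 : (S : Subset d) → ⟪ 𝟙 S , 𝟙 S ⟫ ≡ ∣ S ∣
dot-𝟙-𝟙 []          = refl
dot-𝟙-𝟙 (true ∷ S)  = cong suc (dot-𝟙-𝟙 S)
dot-𝟙-𝟙 (false ∷ S) = dot-𝟙-𝟙 S

dot-𝟙≡0 : (S T : Subset d) → (∀ i → i ∈ S → i ∉ T) → ⟪ 𝟙 S , 𝟙 T ⟫ ≡ 0
dot-𝟙≡0 []          []          _    = refl
dot-𝟙≡0 (true ∷ S)  (true ∷ T)  disj = contradiction Vec.here (disj zero Vec.here)
dot-𝟙≡0 (true ∷ S)  (false ∷ T) disj = dot-𝟙≡0 S T λ i p q → disj (suc i) (Vec.there p) (Vec.there q)
dot-𝟙≡0 (false ∷ S) (_ ∷ T)     disj = dot-𝟙≡0 S T λ i p q → disj (suc i) (Vec.there p) (Vec.there q)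

dot-𝟙≤1 : (S T : Subset d) →
  (∀ i j → i ∈ S → j ∈ S → i ∈ T → j ∈ T → i ≡ j) → ⟪ 𝟙 S , 𝟙 T ⟫ ≤ 1
dot-𝟙≤1 {zero}  []      []      _    = z≤n
dot-𝟙≤1 {suc _} (s ∷ S) (t ∷ T) uniq = head s t uniq
  where
  tail : (∀ i j → i ∈ s ∷ S → j ∈ s ∷ S → i ∈ t ∷ T → j ∈ t ∷ T → i ≡ j) → ⟪ 𝟙 S , 𝟙 T ⟫ ≤ 1
  tail uniq = dot-𝟙≤1 S T λ i j a b c e → Fin.suc-injective
    (uniq (suc i) (suc j) (Vec.there a) (Vec.there b) (Vec.there c) (Vec.there e))
  head : ∀ x y → (∀ i j → i ∈ x ∷ S → j ∈ x ∷ S → i ∈ y ∷ T → j ∈ y ∷ T → i ≡ j) →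
    ⟪ 𝟙 (x ∷ S) , 𝟙 (y ∷ T) ⟫ ≤ 1
  head false y     _    = tail uniq
  head true  false _    = tail uniq
  head true  true  uniq = s≤s (≤-reflexive (dot-𝟙≡0 S T λ i i∈S i∈T →
    contradiction (uniq zero (suc i) Vec.here (Vec.there i∈S) Vec.here (Vec.there i∈T)) λ()))

total-++ : (Us Vs : List (Subset d)) → total (Us ++ Vs) ≡ total Us ⊕ total Vs
total-++ []       Vs = sym (⊕-identityˡ _)
total-++ (U ∷ Us) Vs = trans (cong (𝟙 U ⊕_) (total-++ Us Vs)) (sym (⊕-assoc (𝟙 U) _ _))

dot-total-≤ : (u : Weight d) (b : ℕ) (Ws : List (Subset d)) →
  All (λ W → ⟪ u , 𝟙 W ⟫ ≤ b) Ws → ⟪ u , total Ws ⟫ ≤ length Ws * b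
dot-total-≤ u b [] [] = ≤-reflexive (dot-𝟎ʳ u)
dot-total-≤ u b (W ∷ Ws) (p ∷ ps) =
  ≤-trans (≤-reflexive (dot-⊕ʳ u (𝟙 W) (total Ws))) (+-mono-≤ p (dot-total-≤ u b Ws ps))

dot-total-≥ : (u : Weight d) (b : ℕ) (Ws : List (Subset d)) →
  All (λ W → b ≤ ⟪ u , 𝟙 W ⟫) Ws → length Ws * b ≤ ⟪ u , total Ws ⟫
dot-total-≥ u b [] [] = z≤n
dot-total-≥ u b (W ∷ Ws) (p ∷ ps) =
  ≤-trans (+-mono-≤ p (dot-total-≥ u b Ws ps)) (≤-reflexive (sym (dot-⊕ʳ u (𝟙 W) (total Ws))))

-- Weighted perfection

SetFamily : ℕ → Set₁
SetFamily d = Subset d → Set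

DownClosed : SetFamily d → Set
DownClosed A = ∀ {S T} → S ⊆ T → A T → A S

-- Members may repeat, and the length is exact; when `A` contains `∅`, `decomposition-pad` makes
-- this the same as a bound on the length. For stable sets and the weight `𝟙 S` the members are the
-- colour classes of a colouring of `S`.
Decomposition : SetFamily d → ℕ → Weight d → Set
Decomposition A t w = ∃[ Ws ] (length Ws ≡ t × All A Ws × total Ws ≡ w)

module _ {A : SetFamily d} where

  decomposition-𝟎 : Decomposition A 0 𝟎
  decomposition-𝟎 = [] , refl , [] , refl

  decomposition-𝟙 : ∀ {W} → A W → Decomposition A 1 (𝟙 W)
  decomposition-𝟙 {W} a = W ∷ [] , refl , a ∷ [] , ⊕-identityʳ _

  decomposition-⊕ : ∀ {s t u v} → Decomposition A s u → Decomposition A t v → Decomposition A (s + t) (u ⊕ v)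
  decomposition-⊕ (Us , lu , au , tu) (Vs , lv , av , tv) =
    Us ++ Vs , trans (length-++ Us) (cong₂ _+_ lu lv) , All.++⁺ au av , trans (total-++ Us Vs) (cong₂ _⊕_ tu tv)

  decomposition-pad : A ∅ → ∀ {s t w} → s ≤ t → Decomposition A s w → Decomposition A t w
  decomposition-pad a∅ {w = w} s≤t D with m≤n⇒∃[o]m+o≡n s≤t
  ... | o , refl = subst (Decomposition A _) (⊕-identityʳ w) (decomposition-⊕ D (zeros o))
    where
    zeros : ∀ o → Decomposition A o 𝟎
    zeros zero    = decomposition-𝟎
    zeros (suc o) = subst (Decomposition A _) (trans (cong (_⊕ 𝟎) 𝟙-∅) (⊕-identityˡ 𝟎))
      (decomposition-⊕ (decomposition-𝟙 a∅) (zeros o))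

  pick : ∀ v Ws → All A Ws → 1 ≤ lookup (total Ws) v →
    ∃₂ λ W Ws′ → A W × v ∈ W × All A Ws′ × length Ws ≡ suc (length Ws′) × total Ws ≡ 𝟙 W ⊕ total Ws′
  pick v [] [] pos = contradiction (≤-trans pos (≤-reflexive (Vec.lookup-replicate v 0))) λ()
  pick v (W ∷ Ws) (a ∷ as) pos with v ∈? W
  ... | yes v∈W = W , Ws , a , v∈W , as , refl , refl
  ... | no  v∉W with pick v Ws as (≤-trans pos (≤-reflexive
                       (trans (lookup-⊕ (𝟙 W) _ v) (cong (_+ lookup (total Ws) v) (𝟙-∉ v∉W)))))
  ... | V , Ws′ , aV , v∈V , as′ , l , eq =
    V , W ∷ Ws′ , aV , v∈V , a ∷ as′ , cong suc l , trans (cong (𝟙 W ⊕_) eq) (⊕-swap (𝟙 W) (𝟙 V) _)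

module _ (A : SetFamily d) (A? : Decidable A) where

  -- Exhaustive search over the first member. Decidability is what later lets `least` produce a
  -- chromatic number.
  decomposition? : ∀ t w → Dec (Decomposition A t w)
  decomposition? zero w = map′ (λ { refl → decomposition-𝟎 }) (λ { ([] , _ , _ , eq) → sym eq })
    (Vec.≡-dec _≟_ w 𝟎)
  decomposition? (suc t) w = map′ to from
    -- The equation in the middle is a guard: `rest` subtracts with truncation and is a true
    -- remainder only if `W` fits under `w`.
    (anySubset? λ W → A? W ×-dec Vec.≡-dec _≟_ w (𝟙 W ⊕ rest W) ×-dec decomposition? t (rest W))
    where
    rest : Subset d → Weight d
    rest W = zipWith _∸_ w (𝟙 W)
    rest-⊕ : ∀ {d} (u v : Weight d) → zipWith _∸_ (u ⊕ v) u ≡ v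
    rest-⊕ []      []      = refl
    rest-⊕ (m ∷ u) (n ∷ v) = cong₂ _∷_ (m+n∸m≡n m n) (rest-⊕ u v)
    to : (∃ λ W → A W × w ≡ 𝟙 W ⊕ rest W × Decomposition A t (rest W)) → Decomposition A (suc t) w
    to (W , a , eq , D) = subst (Decomposition A _) (sym eq) (decomposition-⊕ (decomposition-𝟙 a) D)
    from : Decomposition A (suc t) w → ∃ λ W → A W × w ≡ 𝟙 W ⊕ rest W × Decomposition A t (rest W)
    from (W ∷ Ws , l , a ∷ as , refl) = W , a , cong (𝟙 W ⊕_) (sym eq) , Ws , suc-injective l , as , sym eq
      where eq = rest-⊕ (𝟙 W) (total Ws)

-- χ(w) ≤ ω(w) for every weight w, when A and B are the stable sets and the cliques of a graph.
WeightedPerfect : SetFamily d → SetFamily d → Set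
WeightedPerfect A B = ∀ w t → (∀ C → B C → ⟪ w , 𝟙 C ⟫ ≤ t) → Decomposition A t w

-- The interplay of stable sets and cliques, stated for set families so that both of Lovász's
-- arguments run without a graph.
MeetOnce : SetFamily d → SetFamily d → Set
MeetOnce A B = ∀ W C → A W → B C → ⟪ 𝟙 W , 𝟙 C ⟫ ≤ 1

-- The 0/1 weights are the base case of replication; any other weight has a vertex from which a
-- duplicate can be removed.
0/1-or-≥2 : (w : Weight d) → (∃[ S ] w ≡ 𝟙 S) ⊎ (∃[ v ] 2 ≤ lookup w v)
0/1-or-≥2 [] = inj₁ ([] , refl)
0/1-or-≥2 (suc (suc _) ∷ w) = inj₂ (zero , s≤s (s≤s z≤n))
0/1-or-≥2 (zero ∷ w) with 0/1-or-≥2 w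
... | inj₁ (S , eq) = inj₁ (false ∷ S , cong (0 ∷_) eq)
... | inj₂ (v , p)  = inj₂ (suc v , p)
0/1-or-≥2 (suc zero ∷ w) with 0/1-or-≥2 w
... | inj₁ (S , eq) = inj₁ (true ∷ S , cong (1 ∷_) eq)
... | inj₂ (v , p)  = inj₂ (suc v , p)

module _ {A B : SetFamily d} (meet : MeetOnce A B) where

  -- Lovász's replication lemma: a colour class of w − e_v containing v meets every clique that is tight for w.
  replication :
    (∀ S t → (∀ C → B C → ⟪ 𝟙 S , 𝟙 C ⟫ ≤ t) → Decomposition A t (𝟙 S)) → WeightedPerfect A B
  replication base w t bound = go ⟪ w , 𝟙 ⊤ ⟫ w t ≤-refl bound
    where
    size-< : ∀ {W v} (w : Weight d) → v ∈ W → suc ⟪ w , 𝟙 ⊤ ⟫ ≤ ⟪ 𝟙 W ⊕ w , 𝟙 ⊤ ⟫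
    size-< {W} {v} w v∈W = ≤-trans
      (+-monoˡ-≤ _ (≤-trans (≤-reflexive (sym (𝟙-∈ v∈W))) (lookup≤dot (𝟙 W) {⊤} {v} ∈⊤)))
      (≤-reflexive (sym (dot-⊕ˡ (𝟙 W) w (𝟙 ⊤))))
    -- Induction on a bound `n` for the total weight.
    go : ∀ n w t → ⟪ w , 𝟙 ⊤ ⟫ ≤ n → (∀ C → B C → ⟪ w , 𝟙 C ⟫ ≤ t) → Decomposition A t w
    go n w t size bound with 0/1-or-≥2 w
    ... | inj₁ (S , refl) = base S t bound
    ... | inj₂ (v , w[v]≥2) with subtract-𝟙 ⁅ v ⁆ w (λ i i∈ → subst (λ j → 1 ≤ lookup w j)
                                   (sym (x∈⁅y⁆⇒x≡y v i∈)) (<⇒≤ w[v]≥2))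
    go zero w t size bound | inj₂ (v , _) | w₁ , refl = contradiction (≤-trans (size-< w₁ (x∈⁅x⁆ v)) size) λ()
    -- `w₁` is `w` with one copy of `v` removed. As `w` has at least two copies, some class in the
    -- decomposition of `w₁` contains `v`.
    go (suc n) w t size bound | inj₂ (v , w[v]≥2) | w₁ , refl
      with go n w₁ t (s≤s⁻¹ (≤-trans (size-< w₁ (x∈⁅x⁆ v)) size))
             (λ C b → ≤-trans (dot-⊕ˡ-≤ (𝟙 ⁅ v ⁆) w₁ (𝟙 C)) (bound C b))
    ... | Ws , refl , as , refl
      with pick v Ws as (s≤s⁻¹ (≤-trans w[v]≥2 (≤-reflexive
             (trans (lookup-⊕ (𝟙 ⁅ v ⁆) (total Ws) v) (cong (_+ lookup (total Ws) v) (𝟙-∈ (x∈⁅x⁆ v)))))))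
    ... | W , Vs , aW , v∈W , aV , len , eq =
      subst₂ (Decomposition A) (sym len) (sym w≡)
        (decomposition-⊕ (decomposition-𝟙 aW) (go n w₂ (length Vs)
          (s≤s⁻¹ (≤-trans (size-< w₂ v∈W) (subst (λ x → ⟪ x , 𝟙 ⊤ ⟫ ≤ suc n) w≡ size))) bound₂))
      where
      -- What remains of `w` without the class `W`: the other classes and the removed copy of `v`.
      w₂ = 𝟙 ⁅ v ⁆ ⊕ total Vs
      w≡ : 𝟙 ⁅ v ⁆ ⊕ total Ws ≡ 𝟙 W ⊕ w₂
      w≡ = trans (cong (𝟙 ⁅ v ⁆ ⊕_) eq) (⊕-swap (𝟙 ⁅ v ⁆) (𝟙 W) (total Vs))
      bound₂ : ∀ C → B C → ⟪ w₂ , 𝟙 C ⟫ ≤ length Vs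
      bound₂ C b with ⟪ 𝟙 W , 𝟙 C ⟫ in W∙C
      -- A member of `B` that meets `W` loses at least one unit of weight.
      ... | suc k = s≤s⁻¹ (begin
        suc ⟪ w₂ , 𝟙 C ⟫              ≤⟨ +-monoˡ-≤ _ (s≤s z≤n) ⟩
        suc k + ⟪ w₂ , 𝟙 C ⟫          ≡⟨ cong (_+ _) W∙C ⟨
        ⟪ 𝟙 W , 𝟙 C ⟫ + ⟪ w₂ , 𝟙 C ⟫  ≡⟨ dot-⊕ˡ (𝟙 W) w₂ (𝟙 C) ⟨
        ⟪ 𝟙 W ⊕ w₂ , 𝟙 C ⟫            ≡⟨ cong (λ x → ⟪ x , 𝟙 C ⟫) w≡ ⟨
        ⟪ 𝟙 ⁅ v ⁆ ⊕ total Ws , 𝟙 C ⟫  ≤⟨ bound C b ⟩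
        length Ws                     ≡⟨ len ⟩
        suc (length Vs)               ∎)
        where open ≤-Reasoning
      -- A member that misses `W` also misses `v`, so only the classes in `Vs` count, each at most
      -- once.
      ... | zero = begin
        ⟪ w₂ , 𝟙 C ⟫                            ≡⟨ dot-⊕ˡ (𝟙 ⁅ v ⁆) (total Vs) (𝟙 C) ⟩
        ⟪ 𝟙 ⁅ v ⁆ , 𝟙 C ⟫ + ⟪ total Vs , 𝟙 C ⟫  ≤⟨ +-monoˡ-≤ _ (≤-trans (dot-⊆ˡ (𝟙 C) (⁅⁆⊆ v∈W)) (≤-reflexive W∙C)) ⟩
        ⟪ total Vs , 𝟙 C ⟫                      ≡⟨ dot-comm (total Vs) (𝟙 C) ⟩
        ⟪ 𝟙 C , total Vs ⟫                      ≤⟨ dot-total-≤ (𝟙 C) 1 Vs (All.map (λ {V} a →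
                                                     subst (_≤ 1) (dot-comm (𝟙 V) (𝟙 C)) (meet V C a b)) aV) ⟩
        length Vs * 1                           ≡⟨ *-identityʳ _ ⟩
        length Vs                               ∎
        where open ≤-Reasoning

subsets : ∀ d → List (Subset d)
subsets zero    = [] ∷ []
subsets (suc d) = List.map (true ∷_) (subsets d) ++ List.map (false ∷_) (subsets d)

∈-subsets : (S : Subset d) → S ∈ˡ subsets d
∈-subsets []          = here refl
∈-subsets (true ∷ S)  = ∈ˡ.∈-++⁺ˡ (∈ˡ.∈-map⁺ (true ∷_) (∈-subsets S))
∈-subsets (false ∷ S) = ∈ˡ.∈-++⁺ʳ _ (∈ˡ.∈-map⁺ (false ∷_) (∈-subsets S))

support : Weight d → Subset d
support = map (0 <ᵇ_)

∈-support : (w : Weight d) {i : Fin d} → i ∈ support w → 1 ≤ lookup w i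
∈-support (suc _ ∷ w) Vec.here        = s≤s z≤n
∈-support (_ ∷ w)     (Vec.there i∈S) = ∈-support w i∈S

dot-support : (w : Weight d) (S : Subset d) → ⟪ w , 𝟙 (S ∩ support w) ⟫ ≡ ⟪ w , 𝟙 S ⟫
dot-support []          []          = refl
dot-support (zero ∷ w)  (true ∷ S)  = dot-support w S
dot-support (suc n ∷ w) (true ∷ S)  = cong (λ x → suc n * 1 + x) (dot-support w S)
dot-support (zero ∷ w)  (false ∷ S) = dot-support w S
dot-support (suc n ∷ w) (false ∷ S) = cong (λ x → suc n * 0 + x) (dot-support w S)

module _ {A B : SetFamily d} (A? : Decidable A) (B? : Decidable B) (meet : MeetOnce A B)
  (A-down : DownClosed A) (B-down : DownClosed B) (A-⁅⁆ : ∀ v → A ⁅ v ⁆) (B-∅ : B ∅) where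

  -- Lovász's duality argument: were each C ∈ B missed by some W_C ∈ A of maximal u-weight, the sum of
  -- all W_C would split into fewer members of A than it is made of, none of which is heavier than W_C.
  weightedPerfect-dual : WeightedPerfect A B → WeightedPerfect B A
  -- The singletons in `A` force `u` to vanish.
  weightedPerfect-dual perfect u zero bound = subst (Decomposition B 0) (lookup-ext u≡0) decomposition-𝟎
    where
    u≡0 : ∀ i → lookup 𝟎 i ≡ lookup u i
    u≡0 i = trans (Vec.lookup-replicate i 0)
      (sym (n≤0⇒n≡0 (≤-trans (lookup≤dot u (x∈⁅x⁆ i)) (bound ⁅ i ⁆ (A-⁅⁆ i)))))
  weightedPerfect-dual perfect u (suc α) bound = step (anySubset? λ C → B? C ×-dec ¬? (missed? C))
    where
    Missed : Subset d → Set
    Missed C = ∃ λ W → A W × suc α ≤ ⟪ u , 𝟙 W ⟫ × ⟪ 𝟙 C , 𝟙 W ⟫ ≡ 0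

    missed? : Decidable Missed
    missed? C = anySubset? λ W → A? W ×-dec suc α ≤? ⟪ u , 𝟙 W ⟫ ×-dec ⟪ 𝟙 C , 𝟙 W ⟫ ≟ 0

    -- One heavy set is chosen for each `C` in `L`. Every `D` in `B` meets each chosen set at most
    -- once, and a `D` from `L` misses the one chosen for it, whence the strict bound.
    sweep : (∀ C → B C → Missed C) → ∀ L → All B L → ∃ λ Ws →
      length Ws ≡ length L × All (λ W → suc α ≤ ⟪ u , 𝟙 W ⟫) Ws ×
      (∀ C → B C → ⟪ total Ws , 𝟙 C ⟫ ≤ length L) ×
      (∀ C → B C → C ∈ˡ L → ⟪ total Ws , 𝟙 C ⟫ < length L)
    sweep f [] [] = [] , refl , [] , (λ C _ → ≤-reflexive (dot-𝟎ˡ (𝟙 C))) , λ _ _ ()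
    sweep f (C ∷ L) (b ∷ bs) with f C b | sweep f L bs
    ... | W , a , big , miss | Ws , len , bigs , ≤L , <L =
      W ∷ Ws , cong suc len , big ∷ bigs ,
      (λ D bD → split id D (+-mono-≤ (meet W D a bD) (≤L D bD))) ,
      λ { D bD (here refl) → split suc D (s≤s (+-mono-≤ (≤-reflexive (trans (dot-comm (𝟙 W) (𝟙 D)) miss)) (≤L D bD)))
        ; D bD (there D∈L) → split suc D (≤-trans (≤-reflexive (sym (+-suc _ _))) (+-mono-≤ (meet W D a bD) (<L D bD D∈L))) }
      where
      split : ∀ (f : ℕ → ℕ) D {n} → f (⟪ 𝟙 W , 𝟙 D ⟫ + ⟪ total Ws , 𝟙 D ⟫) ≤ n → f ⟪ 𝟙 W ⊕ total Ws , 𝟙 D ⟫ ≤ n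
      split f D = subst (λ m → f m ≤ _) (sym (dot-⊕ˡ (𝟙 W) (total Ws) (𝟙 D)))

    members = List.filter B? (subsets d)

    ∈-members : ∀ C → B C → C ∈ˡ members
    ∈-members C = ∈ˡ.∈-filter⁺ B? (∈-subsets C)

    step : Dec (∃ λ C → B C × ¬ Missed C) → Decomposition B (suc α) u
    -- No heavy set misses `C`: removing one copy of its part inside the support lowers the maximal
    -- weight to `α`.
    step (yes (C , b , ¬miss)) with subtract-𝟙 (C ∩ support u) u (λ i → ∈-support u ∘ proj₂ ∘ x∈p∩q⁻ C (support u))
    ... | u′ , u≡ = subst (Decomposition B (suc α)) (sym u≡)
      (decomposition-⊕ (decomposition-𝟙 (B-down (p∩q⊆p C (support u)) b)) (weightedPerfect-dual perfect u′ α bound′))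
      where
      bound′ : ∀ W → A W → ⟪ u′ , 𝟙 W ⟫ ≤ α
      bound′ W a with ⟪ 𝟙 (C ∩ support u) , 𝟙 W ⟫ in C∙W | ⟪ u′ , 𝟙 W ⟫ ≤? α
      ... | _     | yes ≤α = ≤α
      ... | suc k | no  _  = s≤s⁻¹ (begin
        suc ⟪ u′ , 𝟙 W ⟫                               ≤⟨ s≤s (m≤n+m _ k) ⟩
        suc k + ⟪ u′ , 𝟙 W ⟫                           ≡⟨ cong (_+ ⟪ u′ , 𝟙 W ⟫) C∙W ⟨
        ⟪ 𝟙 (C ∩ support u) , 𝟙 W ⟫ + ⟪ u′ , 𝟙 W ⟫     ≡⟨ dot-⊕ˡ (𝟙 (C ∩ support u)) u′ (𝟙 W) ⟨
        ⟪ 𝟙 (C ∩ support u) ⊕ u′ , 𝟙 W ⟫               ≡⟨ cong (λ v → ⟪ v , 𝟙 W ⟫) u≡ ⟨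
        ⟪ u , 𝟙 W ⟫                                    ≤⟨ bound W a ⟩
        suc α                                          ∎)
        where open ≤-Reasoning
      -- `W` is too heavy for `u′` and disjoint from `C ∩ support u`. Cut down to the support it
      -- keeps its `u`-weight and misses `C`.
      ... | zero  | no  ≰α = contradiction
        (W ∩ support u , A-down (p∩q⊆p W (support u)) a , heavy , trans (sym (dot-𝟙-∩ C (support u) W)) C∙W) ¬miss
        where
        open ≤-Reasoning
        heavy : suc α ≤ ⟪ u , 𝟙 (W ∩ support u) ⟫
        heavy = begin
          suc α                             ≤⟨ ≰⇒> ≰α ⟩
          ⟪ u′ , 𝟙 W ⟫                      ≤⟨ dot-⊕ˡ-≤ (𝟙 (C ∩ support u)) u′ (𝟙 W) ⟩
          ⟪ 𝟙 (C ∩ support u) ⊕ u′ , 𝟙 W ⟫  ≡⟨ cong (λ v → ⟪ v , 𝟙 W ⟫) u≡ ⟨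
          ⟪ u , 𝟙 W ⟫                       ≡⟨ dot-support u W ⟨
          ⟪ u , 𝟙 (W ∩ support u) ⟫         ∎
    step (no ¬C) with sweep (λ C b → decidable-stable (missed? C) λ ¬m → ¬C (C , b , ¬m))
                         members (All.all-filter B? (subsets d))
    -- `∅` occurs in `members`, so that list is nonempty and its length is some `suc t`.
    ... | Ws , len , heavy , _ , <L with <⇒≢ (≤-<-trans z≤n (<L ∅ B-∅ (∈-members ∅ B-∅)))
    ... | 0≢ with length members
    ... | zero  = contradiction refl 0≢
    -- The strict bounds allow `t` sets to replace the `suc t` heavy ones, although none of the `t`
    -- weighs more than `suc α`.
    ... | suc t with perfect (total Ws) t (λ C b → s≤s⁻¹ (<L C b (∈-members C b)))
    ... | Vs , refl , as , eq = contradiction (begin-strict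
      length Vs * suc α        <⟨ *-monoˡ-< (suc α) (n<1+n (length Vs)) ⟩
      suc (length Vs) * suc α  ≡⟨ cong (_* suc α) len ⟨
      length Ws * suc α        ≤⟨ dot-total-≥ u (suc α) Ws heavy ⟩
      ⟪ u , total Ws ⟫         ≡⟨ cong ⟪ u ,_⟫ eq ⟨
      ⟪ u , total Vs ⟫         ≤⟨ dot-total-≤ u (suc α) Vs (All.map (bound _) as) ⟩
      length Vs * suc α        ∎) (<-irrefl refl)
      where open ≤-Reasoning

-- Rational convex hulls of integer points

/-≡ : ∀ a b m n → a ℤ.* + suc n ≡ b ℤ.* + suc m → a ℚ./ suc m ≡ b ℚ./ suc n
/-≡ a b m n eq = ℚ.fromℚᵘ-cong {mkℚᵘ a m} {mkℚᵘ b n} (*≡* eq)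

toℚᵘ-/ : ∀ a m → ℚ.toℚᵘ (a ℚ./ suc m) ℚᵘ.≃ mkℚᵘ a m
toℚᵘ-/ a m = ℚ.toℚᵘ-fromℚᵘ (mkℚᵘ a m)

/-homo-+ : ∀ a b m → (a ℤ.+ b) ℚ./ suc m ≡ a ℚ./ suc m ℚ.+ b ℚ./ suc m
/-homo-+ a b m = ℚ.toℚᵘ-injective (begin
  ℚ.toℚᵘ ((a ℤ.+ b) ℚ./ suc m)                        ≈⟨ toℚᵘ-/ (a ℤ.+ b) m ⟩
  mkℚᵘ (a ℤ.+ b) m                                    ≈⟨ *≡* (eq a b (+ suc m)) ⟩
  mkℚᵘ a m ℚᵘ.+ mkℚᵘ b m                              ≈⟨ ℚᵘ.+-cong (toℚᵘ-/ a m) (toℚᵘ-/ b m) ⟨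
  ℚ.toℚᵘ (a ℚ./ suc m) ℚᵘ.+ ℚ.toℚᵘ (b ℚ./ suc m)      ≈⟨ ℚ.toℚᵘ-homo-+ (a ℚ./ suc m) (b ℚ./ suc m) ⟨
  ℚ.toℚᵘ (a ℚ./ suc m ℚ.+ b ℚ./ suc m)                ∎)
  where
  open ℚᵘ.≃-Reasoning
  eq : ∀ a b c → (a ℤ.+ b) ℤ.* (c ℤ.* c) ≡ (a ℤ.* c ℤ.+ b ℤ.* c) ℤ.* c
  eq = solveℤ

/-homo-* : ∀ a b m → (a ℤ.* b) ℚ./ suc m ≡ (a ℚ./ suc m) ℚ.* (b ℚ./ 1)
/-homo-* a b m = ℚ.toℚᵘ-injective (begin
  ℚ.toℚᵘ ((a ℤ.* b) ℚ./ suc m)                      ≈⟨ toℚᵘ-/ (a ℤ.* b) m ⟩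
  mkℚᵘ (a ℤ.* b) m                                  ≈⟨ *≡* (cong (λ j → a ℤ.* b ℤ.* + suc j) (*-identityʳ m)) ⟩
  mkℚᵘ a m ℚᵘ.* mkℚᵘ b 0                            ≈⟨ ℚᵘ.*-cong (toℚᵘ-/ a m) (toℚᵘ-/ b 0) ⟨
  ℚ.toℚᵘ (a ℚ./ suc m) ℚᵘ.* ℚ.toℚᵘ (b ℚ./ 1)        ≈⟨ ℚ.toℚᵘ-homo-* (a ℚ./ suc m) (b ℚ./ 1) ⟨
  ℚ.toℚᵘ ((a ℚ./ suc m) ℚ.* (b ℚ./ 1))              ∎)
  where open ℚᵘ.≃-Reasoning

/-cancel-≤ : ∀ {a b m n} → a ℚ./ suc m ℚ.≤ b ℚ./ suc n → a ℤ.* + suc n ℤ.≤ b ℤ.* + suc m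
/-cancel-≤ {a} {b} {m} {n} a/m≤b/n = ℚᵘ.drop-*≤* (begin
  mkℚᵘ a m                ≃⟨ toℚᵘ-/ a m ⟨
  ℚ.toℚᵘ (a ℚ./ suc m)    ≤⟨ ℚ.toℚᵘ-mono-≤ a/m≤b/n ⟩
  ℚ.toℚᵘ (b ℚ./ suc n)    ≃⟨ toℚᵘ-/ b n ⟩
  mkℚᵘ b n                ∎)
  where open ℚᵘ.≤-Reasoning

/-mono-≤ : ∀ {a b m n} → a ℤ.* + suc n ℤ.≤ b ℤ.* + suc m → a ℚ./ suc m ℚ.≤ b ℚ./ suc n
/-mono-≤ {a} {b} {m} {n} le = ℚ.toℚᵘ-cancel-≤ (begin
  ℚ.toℚᵘ (a ℚ./ suc m)    ≃⟨ toℚᵘ-/ a m ⟩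
  mkℚᵘ a m                ≤⟨ *≤* le ⟩
  mkℚᵘ b n                ≃⟨ toℚᵘ-/ b n ⟨
  ℚ.toℚᵘ (b ℚ./ suc n)    ∎)
  where open ℚᵘ.≤-Reasoning

infixl 7 _∙_
_∙_ : Vec ℤ N → Vec ℤ N → ℤ
[]      ∙ []      = + 0
(a ∷ x) ∙ (b ∷ y) = a ℤ.* b ℤ.+ x ∙ y

infixl 6 _⊞_
_⊞_ : Vec ℤ N → Vec ℤ N → Vec ℤ N
_⊞_ = zipWith ℤ._+_

sumᵛ : List (Vec ℤ N) → Vec ℤ N
sumᵛ = List.foldr _⊞_ (Vec.replicate _ (+ 0))

infix 8 _÷suc_
_÷suc_ : Vec ℤ N → ℕ → Vec ℚ N
z ÷suc k = map (λ a → a ℚ./ suc k) z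

dot-÷ : (z c : Vec ℤ N) (k : ℕ) → dot (z ÷suc k) (toℚ c) ≡ (z ∙ c) ℚ./ suc k
dot-÷ []      []      k = /-≡ (+ 0) (+ 0) 0 k refl
dot-÷ (a ∷ z) (b ∷ c) k = sym (trans (/-homo-+ (a ℤ.* b) (z ∙ c) k) (cong₂ ℚ._+_ (/-homo-* a b k) (sym (dot-÷ z c k))))

dotℚ-comm : (x y : Vec ℚ N) → dot x y ≡ dot y x
dotℚ-comm []      []      = refl
dotℚ-comm (p ∷ x) (q ∷ y) = cong₂ ℚ._+_ (ℚ.*-comm p q) (dotℚ-comm x y)

dot-+ᵛ : (x y z : Vec ℚ N) → dot (x +ᵛ y) z ≡ dot x z ℚ.+ dot y z
dot-+ᵛ []      []      []      = refl
dot-+ᵛ (p ∷ x) (q ∷ y) (r ∷ z) =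
  trans (cong₂ ℚ._+_ (ℚ.*-distribʳ-+ r p q) (dot-+ᵛ x y z)) (ℚ+.interchange (p ℚ.* r) (q ℚ.* r) (dot x z) (dot y z))
  where module ℚ+ = CommutativeSemigroupProperties (CommutativeMonoid.commutativeSemigroup ℚ.+-0-commutativeMonoid)

dot-·ᵛ : (q : ℚ) (x z : Vec ℚ N) → dot (q ·ᵛ x) z ≡ q ℚ.* dot x z
dot-·ᵛ q []      []      = sym (ℚ.*-zeroʳ q)
dot-·ᵛ q (p ∷ x) (r ∷ z) =
  trans (cong₂ ℚ._+_ (ℚ.*-assoc q p r) (dot-·ᵛ q x z)) (sym (ℚ.*-distribˡ-+ q (p ℚ.* r) (dot x z)))

dot-0ᵛ : (z : Vec ℚ N) → dot 0ᵛ z ≡ 0ℚ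
dot-0ᵛ []      = refl
dot-0ᵛ (r ∷ z) = trans (cong₂ ℚ._+_ (ℚ.*-zeroˡ r) (dot-0ᵛ z)) (ℚ.+-identityˡ 0ℚ)

conv-≤ : {V : Vec ℤ N → Set} {x : Vec ℚ N} (y : Vec ℚ N) (c : ℚ) →
  (∀ p → V p → dot (toℚ p) y ℚ.≤ c) → InConv V x → dot x y ℚ.≤ c
conv-≤ {N} {V} y c V≤c (_ , ps , ls , Vps , ls≥0 , Σls≡1 , refl) =
  ℚ.≤-trans (bound ps ls Vps ls≥0) (ℚ.≤-reflexive (trans (cong (ℚ._* c) Σls≡1) (ℚ.*-identityˡ c)))
  where
  open ℚ.≤-Reasoning
  bound : ∀ {k} (ps : Vec (Vec ℤ N) k) ls → Vecᴬ.All V ps → Vecᴬ.All (0ℚ ℚ.≤_) ls →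
    dot (combo ls ps) y ℚ.≤ Vec.foldr _ ℚ._+_ 0ℚ ls ℚ.* c
  bound [] [] _ _ = ℚ.≤-reflexive (trans (dot-0ᵛ y) (sym (ℚ.*-zeroˡ c)))
  bound (p ∷ ps) (l ∷ ls) (Vp Vecᴬ.∷ Vps) (l≥0 Vecᴬ.∷ ls≥0) = begin
    dot ((l ·ᵛ toℚ p) +ᵛ combo ls ps) y         ≡⟨ dot-+ᵛ (l ·ᵛ toℚ p) (combo ls ps) y ⟩
    dot (l ·ᵛ toℚ p) y ℚ.+ dot (combo ls ps) y  ≡⟨ cong (ℚ._+ _) (dot-·ᵛ l (toℚ p) y) ⟩
    l ℚ.* dot (toℚ p) y ℚ.+ dot (combo ls ps) y ≤⟨ ℚ.+-mono-≤
      (ℚ.*-monoˡ-≤-nonNeg l {{ℚ.nonNegative l≥0}} (V≤c p Vp)) (bound ps ls Vps ls≥0) ⟩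
    l ℚ.* c ℚ.+ Vec.foldr _ ℚ._+_ 0ℚ ls ℚ.* c   ≡⟨ ℚ.*-distribʳ-+ c l _ ⟨
    (l ℚ.+ Vec.foldr _ ℚ._+_ 0ℚ ls) ℚ.* c       ∎

-- Clears the denominator, so that an inequality valid on the generators becomes a statement about
-- integers.
conv-≤ℤ : {V : Vec ℤ N → Set} (z c : Vec ℤ N) (b : ℤ) → (∀ p → V p → p ∙ c ℤ.≤ b) →
  InConv V (z ÷suc k) → z ∙ c ℤ.≤ b ℤ.* + suc k
conv-≤ℤ {k = k} z c b V≤b conv = subst (ℤ._≤ _) (ℤ.*-identityʳ (z ∙ c)) (/-cancel-≤ {z ∙ c} {b} {k} {0}
  (subst (ℚ._≤ _) (dot-÷ z c k) (conv-≤ (toℚ c) (b ℚ./ 1)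
    (λ p Vp → subst (ℚ._≤ _) (sym (dot-÷ p c 0)) (/-mono-≤ {p ∙ c} {b} {0} {0} (ℤ.*-monoʳ-≤-nonNeg (+ 1) (V≤b p Vp)))) conv)))

-- Uniform weights are enough because a list may repeat its points; integral decompositions become
-- points of the hull this way.
average∈conv : {V : Vec ℤ N → Set} (ps : List (Vec ℤ N)) → All V ps → length ps ≡ suc m → InConv V (sumᵛ ps ÷suc m)
average∈conv {N} {m} {V} ps Vps len =
  length ps , Vec.fromList ps , Vec.replicate _ (+ 1 ℚ./ suc m) , Vecᴬ.fromList⁺ Vps , nonneg (length ps) ,
  trans (weights (length ps)) (/-≡ (+ length ps) (+ 1) m 0
    (trans (cong (λ l → + l ℤ.* + 1) len) (ℤ.*-comm (+ suc m) (+ 1)))) ,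
  points ps
  where
  nonneg : ∀ k → Vecᴬ.All (0ℚ ℚ.≤_) (Vec.replicate k (+ 1 ℚ./ suc m))
  nonneg zero = Vecᴬ.[]
  nonneg (suc k) = /-mono-≤ {+ 0} {+ 1} {0} {m} (ℤ.+≤+ z≤n) Vecᴬ.∷ nonneg k
  weights : ∀ k → Vec.foldr _ ℚ._+_ 0ℚ (Vec.replicate k (+ 1 ℚ./ suc m)) ≡ + k ℚ./ suc m
  weights zero    = /-≡ (+ 0) (+ 0) 0 m refl
  weights (suc k) = trans (cong (+ 1 ℚ./ suc m ℚ.+_) (weights k)) (sym (/-homo-+ (+ 1) (+ k) m))
  zeroPoint : ∀ N → Vec.replicate N (+ 0) ÷suc m ≡ 0ᵛ
  zeroPoint zero    = refl
  zeroPoint (suc N) = cong₂ _∷_ (/-≡ (+ 0) (+ 0) m 0 refl) (zeroPoint N)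
  addPoint : ∀ {N} (p q : Vec ℤ N) → (p ⊞ q) ÷suc m ≡ ((+ 1 ℚ./ suc m) ·ᵛ toℚ p) +ᵛ (q ÷suc m)
  addPoint []      []      = refl
  addPoint (a ∷ p) (b ∷ q) = cong₂ _∷_
    (trans (/-homo-+ a b m) (cong (ℚ._+ _) (trans (cong (ℚ._/ suc m) (sym (ℤ.*-identityˡ a))) (/-homo-* (+ 1) a m))))
    (addPoint p q)
  points : ∀ ps → sumᵛ ps ÷suc m ≡ combo (Vec.replicate _ (+ 1 ℚ./ suc m)) (Vec.fromList ps)
  points []       = zeroPoint N
  points (p ∷ ps) = trans (addPoint p (sumᵛ ps)) (cong (_ +ᵛ_) (points ps))

-- With twice the denominator many points, n + h sets of one sign and n - h of the other can be used
-- whatever the parity of n + h.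
average-of-doubles∈conv : {V : Vec ℤ N → Set} (z : Vec ℤ N) (ps : List (Vec ℤ N)) → All V ps →
  length ps ≡ suc k + suc k → sumᵛ ps ≡ z ⊞ z → InConv V (z ÷suc k)
average-of-doubles∈conv {k = k} {V} z ps Vps len eq =
  subst (InConv V) (trans (cong (_÷suc (k + suc k)) eq) (half z)) (average∈conv ps Vps len)
  where
  half : ∀ {N} (z : Vec ℤ N) → (z ⊞ z) ÷suc (k + suc k) ≡ z ÷suc k
  half []      = refl
  half (a ∷ z) = cong₂ _∷_ (/-≡ (a ℤ.+ a) a (k + suc k) k (eq′ a (+ suc k))) (half z)
    where
    eq′ : ∀ a s → (a ℤ.+ a) ℤ.* s ≡ a ℤ.* (s ℤ.+ s)
    eq′ = solveℤ

commonDenominator : (x : Vec ℚ N) → ∃₂ λ k z → x ≡ z ÷suc k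
commonDenominator []      = 0 , [] , refl
commonDenominator (p ∷ x) with commonDenominator x
-- `suc (e + k * suc e)` is `suc k * suc e` by computation, the product of the two denominators.
... | k , z , refl = e + k * suc e , ℚ.↥ p ℤ.* + suc k ∷ map (ℤ._* + suc e) z ,
  cong₂ _∷_ (trans (sym (ℚ.↥p/↧p≡p p)) (/-≡ (ℚ.↥ p) (ℚ.↥ p ℤ.* + suc k) e (e + k * suc e)
    (head (ℚ.↥ p) (+ suc k) (+ suc e) (ℤ.pos-* (suc k) (suc e)))))
    (tail z)
  where
  e = ℚ.denominator-1 p
  head : ∀ a s t {st} → st ≡ s ℤ.* t → a ℤ.* st ≡ a ℤ.* s ℤ.* t
  head a s t refl = sym (ℤ.*-assoc a s t)
  tail : ∀ {N} (z : Vec ℤ N) → z ÷suc k ≡ map (ℤ._* + suc e) z ÷suc (e + k * suc e)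
  tail []      = refl
  tail (a ∷ z) = cong₂ _∷_
    (/-≡ a (a ℤ.* + suc e) k (e + k * suc e) (eq a (+ suc k) (+ suc e) (ℤ.pos-* (suc k) (suc e)))) (tail z)
    where
    eq : ∀ a s t {st} → st ≡ s ℤ.* t → a ℤ.* st ≡ a ℤ.* t ℤ.* s
    eq a s t refl = trans (cong (a ℤ.*_) (ℤ.*-comm s t)) (sym (ℤ.*-assoc a t s))

-- Graphs and colourings

-- The singletons of the listed vertices form the trivial colouring, with one colour per vertex.
vertices : (S : Subset d) → ∃ λ vs → All (_∈ S) vs × length vs ≡ ∣ S ∣ × total (List.map ⁅_⁆ vs) ≡ 𝟙 S
vertices []      = [] , [] , refl , refl
vertices (s ∷ S) with vertices S
... | vs , vs⊆S , len , eq = cons s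
  where
  shift : ∀ us → total (List.map ⁅_⁆ (List.map suc us)) ≡ 0 ∷ total (List.map ⁅_⁆ us)
  shift []       = refl
  shift (u ∷ us) = cong (𝟙 ⁅ suc u ⁆ ⊕_) (shift us)
  sucs⊆ : ∀ s → All (_∈ s ∷ S) (List.map suc vs)
  sucs⊆ s = All.map⁺ (All.map Vec.there vs⊆S)
  cons : ∀ s → ∃ λ us → All (_∈ s ∷ S) us × length us ≡ ∣ s ∷ S ∣ × total (List.map ⁅_⁆ us) ≡ 𝟙 (s ∷ S)
  cons false = List.map suc vs , sucs⊆ false , trans (length-map suc vs) len , trans (shift vs) (cong (0 ∷_) eq)
  cons true  = zero ∷ List.map suc vs , Vec.here ∷ sucs⊆ true , cong suc (trans (length-map suc vs) len) ,
    trans (cong (𝟙 ⁅ zero ⁆ ⊕_) (shift vs)) (cong (1 ∷_) (trans (cong₂ _⊕_ 𝟙-∅ eq) (⊕-identityˡ _)))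

𝟙-split : (S T : Subset d) → 𝟙 S ≡ 𝟙 (S ∩ T) ⊕ 𝟙 (S ∩ ∁ T)
𝟙-split []          []          = refl
𝟙-split (true ∷ S)  (true ∷ T)  = cong (1 ∷_) (𝟙-split S T)
𝟙-split (true ∷ S)  (false ∷ T) = cong (1 ∷_) (𝟙-split S T)
𝟙-split (false ∷ S) (_ ∷ T)     = cong (0 ∷_) (𝟙-split S T)

card≤dot : {K S : Subset d} → K ⊆ S → ∣ K ∣ ≤ ⟪ 𝟙 S , 𝟙 K ⟫
card≤dot {K = K} K⊆S = ≤-trans (≤-reflexive (sym (dot-𝟙-𝟙 K))) (dot-⊆ˡ (𝟙 K) K⊆S)

-- In `Colouring` a colour depends on a membership proof; this makes the colour of a vertex well
-- defined.
∈-irrelevant : {S : Subset d} {i : Fin d} (p q : i ∈ S) → p ≡ q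
∈-irrelevant Vec.here      Vec.here      = refl
∈-irrelevant (Vec.there p) (Vec.there q) = cong Vec.there (∈-irrelevant p q)

least : {P : ℕ → Set} → Decidable P → ∀ n → P n → ∃ λ k → P k × (∀ m → P m → k ≤ m)
least P? zero    p = 0 , p , λ _ _ → z≤n
least P? (suc n) p with P? 0 | least (P? ∘ suc) n p
... | yes p₀ | _ = 0 , p₀ , λ _ _ → z≤n
... | no ¬p₀ | k , pk , min = suc k , pk , λ { zero p₀ → contradiction p₀ ¬p₀ ; (suc m) pm → s≤s (min m pm) }

module _ {P : Fin d → Set} (P? : Decidable P) where

  ⁅_∣⁆ : Subset d
  ⁅_∣⁆ = Vec.tabulate (does ∘ P?)

  ∈-⁅∣⁆⁺ : ∀ {i} → P i → i ∈ ⁅_∣⁆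
  ∈-⁅∣⁆⁺ {i} p = Vec.lookup⇒[]= i _ (trans (Vec.lookup∘tabulate (does ∘ P?) i) (dec-true (P? i) p))

  ∈-⁅∣⁆⁻ : ∀ {i} → i ∈ ⁅_∣⁆ → P i
  ∈-⁅∣⁆⁻ {i} i∈ with P? i | trans (sym (Vec.lookup∘tabulate (does ∘ P?) i)) (Vec.[]=⇒lookup i∈)
  ... | yes p | _  = p
  ... | no  _ | ()

module _ (G : SimpleGraph d) where

  Stable? : Decidable (Stable G)
  Stable? W = Fin.all? λ i → Fin.all? λ j → i ∈? W →-dec j ∈? W →-dec ¬? (i Fin.≟ j) →-dec E G i j ≟ᵇ false

  Clique? : Decidable (Clique G)
  Clique? C = Fin.all? λ i → Fin.all? λ j → i ∈? C →-dec j ∈? C →-dec ¬? (i Fin.≟ j) →-dec E G i j ≟ᵇ true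

  Stable-down : DownClosed (Stable G)
  Stable-down S⊆T st i j i∈S j∈S = st i j (S⊆T i∈S) (S⊆T j∈S)

  Clique-down : DownClosed (Clique G)
  Clique-down S⊆T cl i j i∈S j∈S = cl i j (S⊆T i∈S) (S⊆T j∈S)

  Stable-∅ : Stable G ∅
  Stable-∅ i j i∈∅ = contradiction i∈∅ ∉⊥

  Clique-∅ : Clique G ∅
  Clique-∅ i j i∈∅ = contradiction i∈∅ ∉⊥

  ⁅⁆-trivial : ∀ v {i j : Fin d} → i ∈ ⁅ v ⁆ → j ∈ ⁅ v ⁆ → i ≡ j
  ⁅⁆-trivial v i∈ j∈ = trans (x∈⁅y⁆⇒x≡y v i∈) (sym (x∈⁅y⁆⇒x≡y v j∈))

  Stable-⁅⁆ : ∀ v → Stable G ⁅ v ⁆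
  Stable-⁅⁆ v i j i∈ j∈ i≢j = contradiction (⁅⁆-trivial v i∈ j∈) i≢j

  Clique-⁅⁆ : ∀ v → Clique G ⁅ v ⁆
  Clique-⁅⁆ v i j i∈ j∈ i≢j = contradiction (⁅⁆-trivial v i∈ j∈) i≢j

  meet-once : MeetOnce (Stable G) (Clique G)
  meet-once W C st cl = dot-𝟙≤1 W C λ i j i∈W j∈W i∈C j∈C → decidable-stable (i Fin.≟ j) λ i≢j →
    contradiction (trans (sym (st i j i∈W j∈W i≢j)) (cl i j i∈C j∈C i≢j)) λ()

  -- The class of the first colour is split off, and `punchOut` renumbers the remaining colours.
  colouring⇒decomposition : ∀ k S → Colouring G S k → Decomposition (Stable G) k (𝟙 S)
  colouring⇒decomposition zero S (c , _) = subst (Decomposition (Stable G) 0) (sym S≡∅) decomposition-𝟎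
    where
    noColour : ¬ Fin 0
    noColour ()
    S≡∅ : 𝟙 S ≡ 𝟎
    S≡∅ = trans (cong 𝟙 (Empty-unique λ (i , i∈S) → noColour (c i i∈S))) 𝟙-∅
  colouring⇒decomposition (suc k) S (c , proper) =
    subst (Decomposition (Stable G) (suc k)) (sym (𝟙-split S W))
      (decomposition-⊕ (decomposition-𝟙 stable) (colouring⇒decomposition k (S ∩ ∁ W) (c′ , proper′)))
    where
    Zero : Fin d → Set
    Zero i = ∃ λ (i∈S : i ∈ S) → c i i∈S ≡ zero
    Zero? : Decidable Zero
    Zero? i with i ∈? S
    ... | no  i∉S = no λ (i∈S , _) → i∉S i∈S
    ... | yes i∈S = map′ (i∈S ,_) (λ (p , eq) → trans (cong (c i) (∈-irrelevant i∈S p)) eq) (c i i∈S Fin.≟ zero)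
    W = ⁅ Zero? ∣⁆
    stable : Stable G (S ∩ W)
    stable i j i∈ j∈ _ with ∈-⁅∣⁆⁻ Zero? (proj₂ (x∈p∩q⁻ S W i∈)) | ∈-⁅∣⁆⁻ Zero? (proj₂ (x∈p∩q⁻ S W j∈)) | E G i j in eq
    ... | _       | _       | false = refl
    ... | p , ci | q , cj | true  = contradiction (trans ci (sym cj)) (proper i j p q eq)
    inS : ∀ {i} → i ∈ S ∩ ∁ W → i ∈ S
    inS = proj₁ ∘ x∈p∩q⁻ S (∁ W)
    nonzero : ∀ {i} (i∈ : i ∈ S ∩ ∁ W) → zero ≢ c i (inS i∈)
    nonzero i∈ eq = x∈∁p⇒x∉p (proj₂ (x∈p∩q⁻ S (∁ W) i∈)) (∈-⁅∣⁆⁺ Zero? (inS i∈ , sym eq))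
    c′ : ∀ i → i ∈ S ∩ ∁ W → Fin k
    c′ i i∈ = punchOut (nonzero i∈)
    proper′ : ∀ i j i∈ j∈ → E G i j ≡ true → c′ i i∈ ≢ c′ j j∈
    proper′ i j i∈ j∈ eq c≡ = proper i j (inS i∈) (inS j∈) eq (Fin.punchOut-injective (nonzero i∈) (nonzero j∈) c≡)

  -- A vertex receives the index of the first set in the list that contains it.
  decomposition⇒colouring : ∀ {k S} → Decomposition (Stable G) k (𝟙 S) → Colouring G S k
  decomposition⇒colouring {S = S} (Ws , refl , st , eq) = (λ i i∈S → proj₁ (class i i∈S)) , proper
    where
    covered : ∀ Ws i → 1 ≤ lookup (total Ws) i → ∃ λ c → i ∈ List.lookup Ws c
    covered [] i pos = contradiction (≤-trans pos (≤-reflexive (Vec.lookup-replicate i 0))) λ()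
    covered (W ∷ Ws) i pos with i ∈? W
    ... | yes i∈W = zero , i∈W
    ... | no  i∉W with covered Ws i (≤-trans pos (≤-reflexive
                         (trans (lookup-⊕ (𝟙 W) _ i) (cong (_+ lookup (total Ws) i) (𝟙-∉ i∉W)))))
    ... | c , i∈ = suc c , i∈
    class : ∀ i → i ∈ S → ∃ λ c → i ∈ List.lookup Ws c
    class i i∈S = covered Ws i (≤-reflexive (sym (trans (cong (λ w → lookup w i) eq) (𝟙-∈ i∈S))))
    proper : ∀ i j (i∈S : i ∈ S) (j∈S : j ∈ S) → E G i j ≡ true → proj₁ (class i i∈S) ≢ proj₁ (class j j∈S)
    proper i j i∈S j∈S edge same with class i i∈S | class j j∈S
    proper i j i∈S j∈S edge refl | c , i∈W | _ , j∈W = contradiction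
      -- Stability concerns distinct vertices; the case of equal ones would be a loop, which
      -- `irrefl` excludes.
      (trans (sym edge) (All.lookup st (∈ˡ.∈-lookup {xs = Ws} c) i j i∈W j∈W λ { refl →
         contradiction (trans (sym edge) (irrefl G i)) λ() }))
      λ()

  -- Downward search from the trivial bound `∣ S ∣`.
  cliqueNumber : ∀ S → ∃ (IsCliqueNumber G S)
  cliqueNumber S = go ∣ S ∣ λ C C⊆S _ → p⊆q⇒∣p∣≤∣q∣ C⊆S
    where
    go : ∀ b → (∀ C → C ⊆ S → Clique G C → ∣ C ∣ ≤ b) → ∃ (IsCliqueNumber G S)
    go b bound with anySubset? (λ C → C ⊆? S ×-dec Clique? C ×-dec ∣ C ∣ ≟ b)
    ... | yes C = b , C , bound
    go zero    bound | no ¬C = contradiction (∅ , (λ {_} → ⊥⊆) , Clique-∅ , ∣⊥∣≡0 d) ¬C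
    go (suc b) bound | no ¬C = go b λ C C⊆S cl →
      s≤s⁻¹ (≤∧≢⇒< (bound C C⊆S cl) λ eq → ¬C (C , C⊆S , cl , eq))

  -- `Perfect` speaks of numbers already known to be chromatic and clique numbers, so both are
  -- exhibited here. Their equality is the 0/1 case from which `replication` starts.
  perfect⇒weightedPerfect : Perfect G → WeightedPerfect (Stable G) (Clique G)
  perfect⇒weightedPerfect perfect = replication meet-once base
    where
    base : ∀ S t → (∀ C → Clique G C → ⟪ 𝟙 S , 𝟙 C ⟫ ≤ t) → Decomposition (Stable G) t (𝟙 S)
    base S t bound with vertices S | cliqueNumber S
    ... | vs , _ , _ , eq | ω , isω@((K , K⊆S , cl , refl) , _)
      with least (λ k → decomposition? (Stable G) Stable? k (𝟙 S)) _
             (List.map ⁅_⁆ vs , refl , All.map⁺ (All.universal Stable-⁅⁆ vs) , eq)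
    ... | χ , D , min = decomposition-pad Stable-∅ (≤-trans (≤-reflexive χ≡ω) (≤-trans (card≤dot K⊆S) (bound K cl))) D
      where
      χ≡ω : χ ≡ ∣ K ∣
      χ≡ω = perfect S χ ∣ K ∣ (decomposition⇒colouring D , λ m → min m ∘ colouring⇒decomposition m S) isω

  perfect⇒weightedPerfect-dual : Perfect G → WeightedPerfect (Clique G) (Stable G)
  perfect⇒weightedPerfect-dual perfect = weightedPerfect-dual Stable? Clique? meet-once
    (λ {S} {T} → Stable-down {S} {T}) (λ {S} {T} → Clique-down {S} {T}) Stable-⁅⁆ Clique-∅ (perfect⇒weightedPerfect perfect)

-- Perfect graphs: facets and decompositions of Ω

-- Linear inequalities are rearranged by comparing differences, which leaves an identity for the
-- ring solver.
≤-by : ∀ {a b c e} → b ℤ.- a ≡ e ℤ.- c → a ℤ.≤ b → c ℤ.≤ e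
≤-by eq a≤b = ℤ.0≤i-j⇒j≤i (subst (+ 0 ℤ.≤_) eq (ℤ.i≤j⇒0≤j-i a≤b))

positivePart : Vec ℤ d → Weight d
positivePart = map pos
  where
  pos : ℤ → ℕ
  pos (+ n)    = n
  pos -[1+ n ] = 0

-- Deleting from `C` the vertices where `z` is not positive stays inside a down-closed family, so a
-- bound for `z` on such a family also bounds its positive part.
∙-ρ-support : (z : Vec ℤ d) (C : Subset d) → z ∙ ρ (C ∩ support (positivePart z)) ≡ + ⟪ positivePart z , 𝟙 C ⟫
∙-ρ-support []            []          = refl
∙-ρ-support (+ zero ∷ z)    (true ∷ C)  = trans (ℤ.+-identityˡ _) (∙-ρ-support z C)
∙-ρ-support (+ suc n ∷ z)   (true ∷ C)  = trans (cong₂ ℤ._+_ (sym (ℤ.pos-* (suc n) 1)) (∙-ρ-support z C)) (sym (ℤ.pos-+ (suc n * 1) _))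
∙-ρ-support (-[1+ n ] ∷ z)  (true ∷ C)  = trans (cong₂ ℤ._+_ (ℤ.*-zeroʳ -[1+ n ]) (∙-ρ-support z C)) (ℤ.+-identityˡ _)
∙-ρ-support (+ n ∷ z)       (false ∷ C) = trans (cong₂ ℤ._+_ (sym (ℤ.pos-* n 0)) (∙-ρ-support z C)) (sym (ℤ.pos-+ (n * 0) _))
∙-ρ-support (-[1+ n ] ∷ z)  (false ∷ C) = trans (cong₂ ℤ._+_ (ℤ.*-zeroʳ -[1+ n ]) (∙-ρ-support z C)) (ℤ.+-identityˡ _)

∙-neg : (z c : Vec ℤ N) → map ℤ.-_ z ∙ c ≡ ℤ.- (z ∙ c)
∙-neg []      []      = refl
∙-neg (a ∷ z) (b ∷ c) = trans (cong (λ s → ℤ.- a ℤ.* b ℤ.+ s) (∙-neg z c)) (eq a b (z ∙ c))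
  where
  eq : ∀ a b s → ℤ.- a ℤ.* b ℤ.+ ℤ.- s ≡ ℤ.- (a ℤ.* b ℤ.+ s)
  eq = solveℤ

∙-comm : (x y : Vec ℤ N) → x ∙ y ≡ y ∙ x
∙-comm []      []      = refl
∙-comm (a ∷ x) (b ∷ y) = cong₂ ℤ._+_ (ℤ.*-comm a b) (∙-comm x y)

∙-scale : (a : ℤ) (x y : Vec ℤ N) → map (a ℤ.*_) x ∙ y ≡ a ℤ.* (x ∙ y)
∙-scale a []      []      = sym (ℤ.*-zeroʳ a)
∙-scale a (b ∷ x) (c ∷ y) = trans (cong (λ s → a ℤ.* b ℤ.* c ℤ.+ s) (∙-scale a x y)) (eq a b c (x ∙ y))
  where
  eq : ∀ a b c s → a ℤ.* b ℤ.* c ℤ.+ a ℤ.* s ≡ a ℤ.* (b ℤ.* c ℤ.+ s)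
  eq = solveℤ

∙-∷ʳ : (x y : Vec ℤ N) (h k : ℤ) → (x ∷ʳ h) ∙ (y ∷ʳ k) ≡ x ∙ y ℤ.+ h ℤ.* k
∙-∷ʳ []      []      h k = ℤ.+-comm (h ℤ.* k) (+ 0)
∙-∷ʳ (a ∷ x) (b ∷ y) h k = trans (cong (λ s → a ℤ.* b ℤ.+ s) (∙-∷ʳ x y h k)) (sym (ℤ.+-assoc (a ℤ.* b) (x ∙ y) _))

∙-ρ-ρ : (S T : Subset d) → ρ S ∙ ρ T ≡ + ⟪ 𝟙 S , 𝟙 T ⟫
∙-ρ-ρ []          []          = refl
∙-ρ-ρ (true ∷ S)  (true ∷ T)  = trans (cong (λ s → + 1 ℤ.+ s) (∙-ρ-ρ S T)) (sym (ℤ.pos-+ 1 _))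
∙-ρ-ρ (true ∷ S)  (false ∷ T) = trans (ℤ.+-identityˡ _) (∙-ρ-ρ S T)
∙-ρ-ρ (false ∷ S) (true ∷ T)  = trans (ℤ.+-identityˡ _) (∙-ρ-ρ S T)
∙-ρ-ρ (false ∷ S) (false ∷ T) = trans (ℤ.+-identityˡ _) (∙-ρ-ρ S T)

⊞-∷ʳ : (x y : Vec ℤ N) (h k : ℤ) → (x ∷ʳ h) ⊞ (y ∷ʳ k) ≡ (x ⊞ y) ∷ʳ (h ℤ.+ k)
⊞-∷ʳ []      []      h k = refl
⊞-∷ʳ (a ∷ x) (b ∷ y) h k = cong (a ℤ.+ b ∷_) (⊞-∷ʳ x y h k)

sumᵛ-++ : (ps qs : List (Vec ℤ N)) → sumᵛ (ps ++ qs) ≡ sumᵛ ps ⊞ sumᵛ qs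
sumᵛ-++ []       qs = sym (Vec.zipWith-identityˡ ℤ.+-identityˡ _)
sumᵛ-++ (p ∷ ps) qs = trans (cong (p ⊞_) (sumᵛ-++ ps qs)) (sym (Vec.zipWith-assoc ℤ.+-assoc p _ _))

point : ℤ → ℤ → Subset d → Vec ℤ (suc d)
point a e W = map (a ℤ.*_) (ρ W) ∷ʳ e

sum-points : ∀ a e (Ws : List (Subset d)) →
  sumᵛ (List.map (point a e) Ws) ≡ map (λ n → a ℤ.* + n) (total Ws) ∷ʳ (e ℤ.* + length Ws)
sum-points a e [] = zeros _
  where
  zeros : ∀ d → Vec.replicate (suc d) (+ 0) ≡ map (λ n → a ℤ.* + n) (Vec.replicate d 0) ∷ʳ (e ℤ.* + 0)
  zeros zero    = cong (_∷ []) (sym (ℤ.*-zeroʳ e))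
  zeros (suc d) = cong₂ _∷_ (sym (ℤ.*-zeroʳ a)) (zeros d)
sum-points a e (W ∷ Ws) = trans (cong (point a e W ⊞_) (sum-points a e Ws))
  (trans (⊞-∷ʳ (map (a ℤ.*_) (ρ W)) _ e _) (cong₂ _∷ʳ_ (coords W (total Ws)) (height e (+ length Ws))))
  where
  height : ∀ e l → e ℤ.+ e ℤ.* l ≡ e ℤ.* (+ 1 ℤ.+ l)
  height = solveℤ
  coords : ∀ {d} (W : Subset d) (w : Weight d) →
    map (a ℤ.*_) (ρ W) ⊞ map (λ n → a ℤ.* + n) w ≡ map (λ n → a ℤ.* + n) (𝟙 W ⊕ w)
  coords []      []      = refl
  coords (b ∷ W) (n ∷ w) = cong₂ _∷_ (head b) (coords W w)
    where
    head : ∀ b → a ℤ.* (if b then + 1 else + 0) ℤ.+ a ℤ.* + n ≡ a ℤ.* + ((if b then 1 else 0) + n)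
    head true  = sym (ℤ.*-distribˡ-+ a (+ 1) (+ n))
    head false = sym (ℤ.*-distribˡ-+ a (+ 0) (+ n))

infixl 6 _⊟_
_⊟_ : Weight d → Weight d → Vec ℤ d
_⊟_ = zipWith (λ m n → + m ℤ.- + n)

positivePart-⊟ : (z : Vec ℤ d) → z ≡ positivePart z ⊟ positivePart (map ℤ.-_ z)
positivePart-⊟ []               = refl
positivePart-⊟ (+ zero ∷ z)     = cong (+ 0 ∷_) (positivePart-⊟ z)
positivePart-⊟ (+ suc n ∷ z)    = cong₂ _∷_ (sym (ℤ.+-identityʳ (+ suc n))) (positivePart-⊟ z)
positivePart-⊟ (-[1+ n ] ∷ z)   = cong (-[1+ n ] ∷_) (positivePart-⊟ z)

sum-signed-points : ∀ a e (Us Vs : List (Subset d)) →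
  sumᵛ (List.map (point a e) Us ++ List.map (point (ℤ.- a) (ℤ.- e)) Vs) ≡
  map (a ℤ.*_) (total Us ⊟ total Vs) ∷ʳ (e ℤ.* (+ length Us ℤ.- + length Vs))
sum-signed-points a e Us Vs = trans (sumᵛ-++ (List.map (point a e) Us) _)
  (trans (cong₂ _⊞_ (sum-points a e Us) (sum-points (ℤ.- a) (ℤ.- e) Vs))
    (trans (⊞-∷ʳ (map (λ n → a ℤ.* + n) (total Us)) _ _ _)
      (cong₂ _∷ʳ_ (coords (total Us) (total Vs)) (eq e (+ length Us) (+ length Vs)))))
  where
  eq : ∀ e r s → e ℤ.* r ℤ.+ ℤ.- e ℤ.* s ≡ e ℤ.* (r ℤ.- s)
  eq = solveℤ
  coords : ∀ {d} (u v : Weight d) →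
    map (λ n → a ℤ.* + n) u ⊞ map (λ n → ℤ.- a ℤ.* + n) v ≡ map (a ℤ.*_) (u ⊟ v)
  coords []      []      = refl
  coords (m ∷ u) (n ∷ v) = cong₂ _∷_ (eq a (+ m) (+ n)) (coords u v)

-- The parameters 1, 1 with stable sets give the generators of Ω; 2, -1 with cliques give the
-- normals of its bounding inequalities. One decomposition lemma thus serves the polytope and its
-- polar.
SignedPoint : ℤ → ℤ → SetFamily d → SetFamily d → Vec ℤ (suc d) → Set
SignedPoint a e A₁ A₂ p = (∃[ W ] (A₁ W × p ≡ point a e W)) ⊎ (∃[ W ] (A₂ W × p ≡ point (ℤ.- a) (ℤ.- e) W))

module _ {A₁ B₁ A₂ B₂ : SetFamily d} (perfect₁ : WeightedPerfect A₁ B₁) (perfect₂ : WeightedPerfect A₂ B₂)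
  (B₁-down : DownClosed B₁) (B₂-down : DownClosed B₂) where

  -- The positive part of `z` is covered by `r` sets of the first family and the negative part by
  -- `s` sets of the second.
  signed-decomposition : ∀ a e z r s → (∀ C → B₁ C → z ∙ ρ C ℤ.≤ + r) → (∀ C → B₂ C → ℤ.- (z ∙ ρ C) ℤ.≤ + s) →
    ∃ λ ps → All (SignedPoint a e A₁ A₂) ps × length ps ≡ r + s ×
             sumᵛ ps ≡ map (a ℤ.*_) z ∷ʳ (e ℤ.* (+ r ℤ.- + s))
  signed-decomposition a e z r s bound₁ bound₂
    with perfect₁ (positivePart z) r (half B₁-down z bound₁)
       | perfect₂ (positivePart (map ℤ.-_ z)) s
           (half B₂-down (map ℤ.-_ z) λ C b → subst (ℤ._≤ _) (sym (∙-neg z (ρ C))) (bound₂ C b))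
    where
    half : {B : SetFamily d} → DownClosed B → ∀ z {r} → (∀ C → B C → z ∙ ρ C ℤ.≤ + r) →
      ∀ C → B C → ⟪ positivePart z , 𝟙 C ⟫ ≤ r
    half B-down z bound C b = ℤ.drop‿+≤+ (subst (ℤ._≤ _) (∙-ρ-support z C) (bound _ (B-down (p∩q⊆p C _) b)))
  ... | Us , refl , as₁ , eq₁ | Vs , refl , as₂ , eq₂ =
    List.map (point a e) Us ++ List.map (point (ℤ.- a) (ℤ.- e)) Vs ,
    All.++⁺ (All.map⁺ (All.map (λ {W} a₁ → inj₁ (W , a₁ , refl)) as₁))
      (All.map⁺ (All.map (λ {W} a₂ → inj₂ (W , a₂ , refl)) as₂)) ,
    trans (length-++ (List.map (point a e) Us)) (cong₂ _+_ (length-map _ Us) (length-map _ Vs)) ,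
    trans (sum-signed-points a e Us Vs) (cong (λ x → map (a ℤ.*_) x ∷ʳ _)
      (trans (cong₂ _⊟_ eq₁ eq₂) (sym (positivePart-⊟ z))))

double : (z : Vec ℤ N) → map (+ 2 ℤ.*_) z ≡ z ⊞ z
double []      = refl
double (a ∷ z) = cong₂ _∷_ (eq a) (double z)
  where
  eq : ∀ a → + 2 ℤ.* a ≡ a ℤ.+ a
  eq = solveℤ

point-1 : (W : Subset d) → point (+ 1) (+ 1) W ≡ ρ W ∷ʳ + 1
point-1 W = cong (_∷ʳ + 1) (trans (Vec.map-cong ℤ.*-identityˡ (ρ W)) (Vec.map-id (ρ W)))

point-neg : (W : Subset d) → point (ℤ.- (+ 1)) (ℤ.- (+ 1)) W ≡ map ℤ.-_ (ρ W) ∷ʳ ℤ.- (+ 1)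
point-neg W = cong (_∷ʳ ℤ.- (+ 1)) (Vec.map-cong ℤ.-1*i≡-i (ρ W))

∷ʳ-∙-point : (z : Vec ℤ d) (h a e : ℤ) (W : Subset d) → (z ∷ʳ h) ∙ point a e W ≡ a ℤ.* (z ∙ ρ W) ℤ.+ h ℤ.* e
∷ʳ-∙-point z h a e W = trans (∙-∷ʳ z _ h e) (cong (λ s → s ℤ.+ h ℤ.* e)
  (trans (∙-comm z _) (trans (∙-scale a (ρ W) z) (cong (a ℤ.*_) (∙-comm (ρ W) z)))))

point-∙-point : (a e b f : ℤ) (W C : Subset d) →
  point a e W ∙ point b f C ≡ b ℤ.* (a ℤ.* + ⟪ 𝟙 W , 𝟙 C ⟫) ℤ.+ e ℤ.* f
point-∙-point a e b f W C = trans (∷ʳ-∙-point (map (a ℤ.*_) (ρ W)) e b f C)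
  (cong (λ s → b ℤ.* s ℤ.+ e ℤ.* f) (trans (∙-scale a (ρ W) (ρ C)) (cong (a ℤ.*_) (∙-ρ-ρ W C))))

∙-ρ-∅ : (z : Vec ℤ d) → z ∙ ρ ∅ ≡ + 0
∙-ρ-∅ []      = refl
∙-ρ-∅ (a ∷ z) = trans (cong₂ ℤ._+_ (ℤ.*-zeroʳ a) (∙-ρ-∅ z)) refl

InConv-mono : {V V′ : Vec ℤ N → Set} {x : Vec ℚ N} → (∀ {p} → V p → V′ p) → InConv V x → InConv V′ x
InConv-mono V⊆V′ (k , ps , ls , Vps , rest) = k , ps , ls , Vecᴬ.map V⊆V′ Vps , rest

generator∈conv : {V : Vec ℤ N → Set} {p : Vec ℤ N} → V p → LatticePt V p
generator∈conv {p = p} Vp = average-of-doubles∈conv {k = 0} p (p ∷ p ∷ []) (Vp ∷ Vp ∷ []) refl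
  (cong (p ⊞_) (Vec.zipWith-identityʳ ℤ.+-identityʳ p))

sumᵛ-fromList : (ps : List (Vec ℤ N)) → sumᵛ ps ≡ Vec.foldr _ (zipWith ℤ._+_) (Vec.replicate _ (+ 0)) (Vec.fromList ps)
sumᵛ-fromList []       = refl
sumᵛ-fromList (p ∷ ps) = cong (p ⊞_) (sumᵛ-fromList ps)

-- An even sum means equal parities. In the odd case one of the `n` summands stays free.
parity-split : ∀ P Q n → P + Q ≡ n + n → ∃₂ λ r s →
  (P ≡ r + r × Q ≡ s + s × r + s ≡ n) ⊎ (P ≡ suc (r + r) × Q ≡ suc (s + s) × suc (r + s) ≡ n)
parity-split zero          Q n       eq = 0 , n , inj₁ (refl , eq , refl)
parity-split (suc zero)    Q (suc n) eq = 0 , n , inj₂ (refl , trans (suc-injective eq) (+-suc n n) , refl)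
parity-split (suc (suc P)) Q (suc n) eq
  with parity-split P Q n (suc-injective (trans (suc-injective eq) (+-suc n n)))
... | r , s , inj₁ (refl , q , l) = suc r , s , inj₁ (cong suc (sym (+-suc r r)) , q , cong suc l)
... | r , s , inj₂ (refl , q , l) = suc r , s , inj₂ (cong (λ x → suc (suc x)) (sym (+-suc r r)) , q , cong suc l)

-- Integral rounding: the source of the floors ⌊(n + h)/2⌋ and ⌊(n - h)/2⌋.
half-≤ : ∀ x r → + 2 ℤ.* x ℤ.≤ + suc (r + r) → x ℤ.≤ + r
half-≤ -[1+ _ ] r _ = ℤ.-≤+
half-≤ (+ m) r 2m≤ = ℤ.+≤+ (≮⇒≥ λ r<m → <⇒≱ (s≤s (≤-reflexive (sym (+-suc r r))) )
  (≤-trans (+-mono-≤ r<m r<m) (≤-trans (≤-reflexive (cong (λ x → m + x) (sym (+-identityʳ m))))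
    (ℤ.drop‿+≤+ (subst (ℤ._≤ _) (sym (ℤ.pos-* 2 m)) 2m≤)))))

nonneg-nat : ∀ {i} → + 0 ℤ.≤ i → ∃ λ n → i ≡ + n
nonneg-nat (ℤ.+≤+ _) = _ , refl

module _ (G₁ G₂ : SimpleGraph d) where

  Ω : Vec ℤ (suc d) → Set
  Ω = ΩGen G₁ G₂

  ΩPoint DualPoint : Vec ℤ (suc d) → Set
  ΩPoint    = SignedPoint (+ 1) (+ 1) (Stable G₁) (Stable G₂)
  DualPoint = SignedPoint (+ 2) (ℤ.- (+ 1)) (Clique G₁) (Clique G₂)

  Ω⇒point : ∀ {p} → Ω p → ΩPoint p
  Ω⇒point (inj₁ (W , st , refl)) = inj₁ (W , st , sym (point-1 W))
  Ω⇒point (inj₂ (W , st , refl)) = inj₂ (W , st , sym (point-neg W))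

  point⇒Ω : ∀ {p} → ΩPoint p → Ω p
  point⇒Ω (inj₁ (W , st , refl)) = inj₁ (W , st , point-1 W)
  point⇒Ω (inj₂ (W , st , refl)) = inj₂ (W , st , point-neg W)

  -- For sets of the same graph the pairing is 2⟪W, C⟫ - 1, and a stable set meets a clique at most
  -- once; for sets of different graphs it is 1 - 2⟪W, C⟫. The bound serves twice: it places Ω
  -- inside the half-spaces and the dual points inside the polar.
  pairing≤1 : ∀ p q → Ω p → DualPoint q → p ∙ q ℤ.≤ + 1
  pairing≤1 p q Ωp = go (Ω⇒point Ωp)
    where
    same : ∀ a b → b ℤ.* a ≡ + 2 → ∀ {m} → m ≤ 1 → b ℤ.* (a ℤ.* + m) ℤ.+ ℤ.- (+ 1) ℤ.≤ + 1
    same a b ba≡2 {m} m≤1 = subst (λ s → s ℤ.+ ℤ.- (+ 1) ℤ.≤ + 1) (ℤ.*-assoc b a (+ m))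
      (subst (λ s → s ℤ.* + m ℤ.+ ℤ.- (+ 1) ℤ.≤ + 1) (sym ba≡2) (bounded m≤1))
      where
      bounded : ∀ {m} → m ≤ 1 → + 2 ℤ.* + m ℤ.+ ℤ.- (+ 1) ℤ.≤ + 1
      bounded z≤n       = ℤ.-≤+
      bounded (s≤s z≤n) = ℤ.≤-refl
    opposite : ∀ a b → b ℤ.* a ≡ ℤ.- (+ 2) → ∀ m → b ℤ.* (a ℤ.* + m) ℤ.+ + 1 ℤ.≤ + 1
    opposite a b ba≡-2 m = subst (λ s → s ℤ.+ + 1 ℤ.≤ + 1) (ℤ.*-assoc b a (+ m))
      (subst (λ s → s ℤ.* + m ℤ.+ + 1 ℤ.≤ + 1) (sym ba≡-2) (≤-by (eq (+ m)) (ℤ.+≤+ {0} {m + m} z≤n)))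
      where
      eq : ∀ x → (x ℤ.+ x) ℤ.- + 0 ≡ + 1 ℤ.- (ℤ.- (+ 2) ℤ.* x ℤ.+ + 1)
      eq = solveℤ
    go : ΩPoint p → DualPoint q → p ∙ q ℤ.≤ + 1
    go (inj₁ (W , st , refl)) (inj₁ (C , cl , refl)) =
      subst (ℤ._≤ + 1) (sym (point-∙-point (+ 1) (+ 1) (+ 2) (ℤ.- (+ 1)) W C))
      (same (+ 1) (+ 2) refl (meet-once G₁ W C st cl))
    go (inj₁ (W , st , refl)) (inj₂ (C , cl , refl)) =
      subst (ℤ._≤ + 1) (sym (point-∙-point (+ 1) (+ 1) (ℤ.- (+ 2)) (+ 1) W C))
      (opposite (+ 1) (ℤ.- (+ 2)) refl ⟪ 𝟙 W , 𝟙 C ⟫)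
    go (inj₂ (W , st , refl)) (inj₁ (C , cl , refl)) =
      subst (ℤ._≤ + 1) (sym (point-∙-point (ℤ.- (+ 1)) (ℤ.- (+ 1)) (+ 2) (ℤ.- (+ 1)) W C))
      (opposite (ℤ.- (+ 1)) (+ 2) refl ⟪ 𝟙 W , 𝟙 C ⟫)
    go (inj₂ (W , st , refl)) (inj₂ (C , cl , refl)) =
      subst (ℤ._≤ + 1) (sym (point-∙-point (ℤ.- (+ 1)) (ℤ.- (+ 1)) (ℤ.- (+ 2)) (+ 1) W C))
      (same (ℤ.- (+ 1)) (ℤ.- (+ 2)) refl (meet-once G₂ W C st cl))

  -- The midpoint of (0, 1) and (0, -1), both of which come from the empty set.
  origin-lattice : LatticePt Ω (Vec.replicate _ (+ 0))
  origin-lattice = average-of-doubles∈conv {k = 0} (Vec.replicate _ (+ 0))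
    (point (+ 1) (+ 1) ∅ ∷ point (ℤ.- (+ 1)) (ℤ.- (+ 1)) ∅ ∷ [])
    (point⇒Ω (inj₁ (∅ , Stable-∅ G₁ , refl)) ∷ point⇒Ω (inj₂ (∅ , Stable-∅ G₂ , refl)) ∷ []) refl (sum≡ d)
    where
    sum≡ : ∀ d → sumᵛ (point (+ 1) (+ 1) (∅ {d}) ∷ point (ℤ.- (+ 1)) (ℤ.- (+ 1)) ∅ ∷ []) ≡
                 Vec.replicate _ (+ 0) ⊞ Vec.replicate _ (+ 0)
    sum≡ zero    = refl
    sum≡ (suc d) = cong (+ 0 ∷_) (sum≡ d)

  -- The inequalities of the dual points, scaled by `n`; for perfect graphs they describe nΩ.
  HalfSpaces : ℤ → Vec ℤ d → ℤ → Set
  HalfSpaces n z h =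
    (∀ C → Clique G₁ C → + 2 ℤ.* (z ∙ ρ C) ℤ.- h ℤ.≤ n) ×
    (∀ C → Clique G₂ C → ℤ.- (+ 2 ℤ.* (z ∙ ρ C)) ℤ.+ h ℤ.≤ n)

  dual⇒halfSpaces : ∀ n z h → (∀ q → DualPoint q → (z ∷ʳ h) ∙ q ℤ.≤ n) → HalfSpaces n z h
  dual⇒halfSpaces n z h bound =
    (λ C cl → subst (ℤ._≤ n) (trans (∷ʳ-∙-point z h (+ 2) (ℤ.- (+ 1)) C) (eq₁ (z ∙ ρ C) h)) (bound _ (inj₁ (C , cl , refl)))) ,
    (λ C cl → subst (ℤ._≤ n) (trans (∷ʳ-∙-point z h (ℤ.- (+ 2)) (+ 1) C) (eq₂ (z ∙ ρ C) h)) (bound _ (inj₂ (C , cl , refl))))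
    where
    eq₁ : ∀ x h → + 2 ℤ.* x ℤ.+ h ℤ.* ℤ.- (+ 1) ≡ + 2 ℤ.* x ℤ.- h
    eq₁ = solveℤ
    eq₂ : ∀ x h → ℤ.- (+ 2) ℤ.* x ℤ.+ h ℤ.* + 1 ≡ ℤ.- (+ 2 ℤ.* x) ℤ.+ h
    eq₂ = solveℤ

  conv⇒halfSpaces : ∀ k z h → InConv Ω ((z ∷ʳ h) ÷suc k) → HalfSpaces (+ suc k) z h
  conv⇒halfSpaces k z h conv = dual⇒halfSpaces (+ suc k) z h λ q Dq →
    subst ((z ∷ʳ h) ∙ q ℤ.≤_) (ℤ.*-identityˡ (+ suc k)) (conv-≤ℤ (z ∷ʳ h) q (+ 1) (λ p Ωp → pairing≤1 p q Ωp Dq) conv)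

  -- The empty clique yields -n ≤ h ≤ n, so n + h and n - h can serve as numbers of sets.
  halfSpaces-height : ∀ n z h → HalfSpaces n z h → (∃ λ P → n ℤ.+ h ≡ + P) × (∃ λ Q → n ℤ.- h ≡ + Q)
  halfSpaces-height n z h (≤₁ , ≤₂) =
    nonneg-nat (≤-by (eq₁ n h) (subst (λ s → + 2 ℤ.* s ℤ.- h ℤ.≤ n) (∙-ρ-∅ z) (≤₁ ∅ (Clique-∅ G₁)))) ,
    nonneg-nat (≤-by (eq₂ n h) (subst (λ s → ℤ.- (+ 2 ℤ.* s) ℤ.+ h ℤ.≤ n) (∙-ρ-∅ z) (≤₂ ∅ (Clique-∅ G₂))))
    where
    eq₁ : ∀ n h → n ℤ.- (+ 2 ℤ.* + 0 ℤ.- h) ≡ n ℤ.+ h ℤ.- + 0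
    eq₁ = solveℤ
    eq₂ : ∀ n h → n ℤ.- (ℤ.- (+ 2 ℤ.* + 0) ℤ.+ h) ≡ n ℤ.- h ℤ.- + 0
    eq₂ = solveℤ

  halfSpaces-≤ : ∀ n z h {P Q} → n ℤ.+ h ≡ P → n ℤ.- h ≡ Q → HalfSpaces n z h →
    (∀ C → Clique G₁ C → + 2 ℤ.* (z ∙ ρ C) ℤ.≤ P) × (∀ C → Clique G₂ C → + 2 ℤ.* ℤ.- (z ∙ ρ C) ℤ.≤ Q)
  halfSpaces-≤ n z h refl refl (≤₁ , ≤₂) =
    (λ C cl → ≤-by (eq₁ n h (z ∙ ρ C)) (≤₁ C cl)) , (λ C cl → ≤-by (eq₂ n h (z ∙ ρ C)) (≤₂ C cl))
    where
    eq₁ : ∀ n h x → n ℤ.- (+ 2 ℤ.* x ℤ.- h) ≡ n ℤ.+ h ℤ.- + 2 ℤ.* x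
    eq₁ = solveℤ
    eq₂ : ∀ n h x → n ℤ.- (ℤ.- (+ 2 ℤ.* x) ℤ.+ h) ≡ n ℤ.- h ℤ.- + 2 ℤ.* ℤ.- x
    eq₂ = solveℤ

  module _ (perfect₁ : WeightedPerfect (Stable G₁) (Clique G₁)) (perfect₂ : WeightedPerfect (Stable G₂) (Clique G₂)) where

    Ω-decomposition : ∀ z r s →
      (∀ C → Clique G₁ C → z ∙ ρ C ℤ.≤ + r) → (∀ C → Clique G₂ C → ℤ.- (z ∙ ρ C) ℤ.≤ + s) →
      ∃ λ ps → All Ω ps × length ps ≡ r + s × sumᵛ ps ≡ z ∷ʳ (+ r ℤ.- + s)
    Ω-decomposition z r s ≤₁ ≤₂
      with signed-decomposition perfect₁ perfect₂ (λ {S} {T} → Clique-down G₁ {S} {T}) (λ {S} {T} → Clique-down G₂ {S} {T})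
             (+ 1) (+ 1) z r s ≤₁ ≤₂
    ... | ps , Ωps , len , eq = ps , All.map point⇒Ω Ωps , len , trans eq
      (cong₂ _∷ʳ_ (trans (Vec.map-cong ℤ.*-identityˡ z) (Vec.map-id z)) (ℤ.*-identityˡ (+ r ℤ.- + s)))

    weightedPerfect⇒IDP : IDP Ω
    weightedPerfect⇒IDP (suc k) a conv with Vec.initLast a
    ... | z , h , refl with conv⇒halfSpaces k z h conv
    ... | half with halfSpaces-height (+ suc k) z h half
    ... | (P , P≡) , (Q , Q≡) with halfSpaces-≤ (+ suc k) z h P≡ Q≡ half
    ... | ≤P , ≤Q = split (parity-split P Q (suc k)
      (ℤ.+-injective (trans (cong₂ ℤ._+_ (sym P≡) (sym Q≡)) (eq (+ suc k) h))))
      where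
      eq : ∀ n h → n ℤ.+ h ℤ.+ (n ℤ.- h) ≡ n ℤ.+ n
      eq = solveℤ
      collect : ∀ {n} (ps : List (Vec ℤ (suc d))) → All (LatticePt Ω) ps → length ps ≡ n → sumᵛ ps ≡ z ∷ʳ h →
        ∃ λ (as : Vec (Vec ℤ (suc d)) n) → Vecᴬ.All (LatticePt Ω) as ×
          z ∷ʳ h ≡ Vec.foldr _ (zipWith ℤ._+_) (Vec.replicate _ (+ 0)) as
      collect ps Lps refl sum≡ = Vec.fromList ps , Vecᴬ.fromList⁺ Lps , trans (sym sum≡) (sumᵛ-fromList ps)
      -- The parity `c`, which is 0 or 1, cancels in P - Q = 2h.
      height : ∀ r s c → + P ≡ c ℤ.+ (+ r ℤ.+ + r) → + Q ≡ c ℤ.+ (+ s ℤ.+ + s) → + r ℤ.- + s ≡ h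
      height r s c P≡r Q≡s = ℤ.*-cancelˡ-≡ (+ 2) (+ r ℤ.- + s) h (trans (eq₁ c (+ r) (+ s))
        (trans (cong₂ ℤ._-_ (trans (sym P≡r) (sym P≡)) (trans (sym Q≡s) (sym Q≡))) (eq₂ (+ suc k) h)))
        where
        eq₁ : ∀ c r s → + 2 ℤ.* (r ℤ.- s) ≡ c ℤ.+ (r ℤ.+ r) ℤ.- (c ℤ.+ (s ℤ.+ s))
        eq₁ = solveℤ
        eq₂ : ∀ n h → n ℤ.+ h ℤ.- (n ℤ.- h) ≡ + 2 ℤ.* h
        eq₂ = solveℤ
      -- Both parities satisfy these bounds, and `half-≤` rounds down in either case.
      decompose : ∀ r s → P ≤ suc (r + r) → Q ≤ suc (s + s) →
        ∃ λ ps → All Ω ps × length ps ≡ r + s × sumᵛ ps ≡ z ∷ʳ (+ r ℤ.- + s)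
      decompose r s P≤ Q≤ = Ω-decomposition z r s
        (λ C cl → half-≤ (z ∙ ρ C) r (ℤ.≤-trans (≤P C cl) (ℤ.+≤+ P≤)))
        (λ C cl → half-≤ (ℤ.- (z ∙ ρ C)) s (ℤ.≤-trans (≤Q C cl) (ℤ.+≤+ Q≤)))
      split : (∃₂ λ r s → (P ≡ r + r × Q ≡ s + s × r + s ≡ suc k) ⊎
                        (P ≡ suc (r + r) × Q ≡ suc (s + s) × suc (r + s) ≡ suc k)) → _
      split (r , s , inj₁ (P≡r , Q≡s , r+s))
        with decompose r s (≤-trans (≤-reflexive P≡r) (n≤1+n _)) (≤-trans (≤-reflexive Q≡s) (n≤1+n _))
      ... | ps , Ωps , len , sum≡ = collect ps (All.map generator∈conv Ωps) (trans len r+s)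
        (trans sum≡ (cong (z ∷ʳ_) (height r s (+ 0) (cong +_ P≡r) (cong +_ Q≡s))))
      split (r , s , inj₂ (P≡r , Q≡s , r+s)) with decompose r s (≤-reflexive P≡r) (≤-reflexive Q≡s)
      -- Here r + s = k, and the origin supplies the missing summand.
      ... | ps , Ωps , len , sum≡ = collect (Vec.replicate _ (+ 0) ∷ ps)
        (origin-lattice ∷ All.map generator∈conv Ωps) (trans (cong suc len) r+s)
        (trans (Vec.zipWith-identityˡ ℤ.+-identityˡ _)
          (trans sum≡ (cong (z ∷ʳ_) (height r s (+ 1) (cong +_ P≡r) (cong +_ Q≡s)))))

    -- Doubling avoids the rounding. With n = k + 1, the positive and negative parts of 2z are
    -- covered by P = n + h and Q = n - h sets, whose points sum to 2(z, h) because P + Q = 2n and P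
    -- - Q = 2h.
    halfSpaces⇒conv : ∀ k z h → HalfSpaces (+ suc k) z h → InConv Ω ((z ∷ʳ h) ÷suc k)
    halfSpaces⇒conv k z h half with halfSpaces-height (+ suc k) z h half
    ... | (P , P≡) , (Q , Q≡) with halfSpaces-≤ (+ suc k) z h P≡ Q≡ half
    ... | ≤P , ≤Q with Ω-decomposition (map (+ 2 ℤ.*_) z) P Q
           (λ C cl → subst (ℤ._≤ + P) (sym (∙-scale (+ 2) z (ρ C))) (≤P C cl))
           (λ C cl → subst (ℤ._≤ + Q) (trans (sym (ℤ.neg-distribʳ-* (+ 2) (z ∙ ρ C)))
             (cong ℤ.-_ (sym (∙-scale (+ 2) z (ρ C))))) (≤Q C cl))
    ... | ps , Ωps , len , sum≡ = average-of-doubles∈conv (z ∷ʳ h) ps Ωps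
      (trans len (ℤ.+-injective (trans (cong₂ ℤ._+_ (sym P≡) (sym Q≡)) (eq₁ (+ suc k) h))))
      (trans sum≡ (trans (cong₂ _∷ʳ_ (double z) (trans (cong₂ ℤ._-_ (sym P≡) (sym Q≡)) (eq₂ (+ suc k) h)))
        (sym (⊞-∷ʳ z z h h))))
      where
      eq₁ : ∀ n h → n ℤ.+ h ℤ.+ (n ℤ.- h) ≡ n ℤ.+ n
      eq₁ = solveℤ
      eq₂ : ∀ n h → n ℤ.+ h ℤ.- (n ℤ.- h) ≡ h ℤ.+ h
      eq₂ = solveℤ

-- Perfect graphs: reflexivity of Ω

i≤+∣i∣ : ∀ i → i ℤ.≤ + ℤ.∣ i ∣
i≤+∣i∣ (+ n)    = ℤ.≤-refl
i≤+∣i∣ -[1+ n ] = ℤ.-≤+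

-- A coordinatewise estimate with denominators cleared: in its use `M` is the reciprocal of the
-- radius and `a` the denominator of the point.
small-dot : ∀ {a b M} (y c : Vec ℤ N) → Vecᴬ.All (λ i → ℤ.∣ i ∣ * M ≤ a) y → Vecᴬ.All (λ i → ℤ.∣ i ∣ ≤ b) c →
  ℤ.∣ y ∙ c ∣ * M ≤ N * (a * b)
small-dot [] [] _ _ = z≤n
small-dot {suc N} {a} {b} {M} (i ∷ y) (j ∷ c) (i≤ Vecᴬ.∷ y≤) (j≤ Vecᴬ.∷ c≤) = begin
  ℤ.∣ i ℤ.* j ℤ.+ y ∙ c ∣ * M               ≤⟨ *-monoˡ-≤ M (ℤ.∣i+j∣≤∣i∣+∣j∣ (i ℤ.* j) (y ∙ c)) ⟩
  (ℤ.∣ i ℤ.* j ∣ + ℤ.∣ y ∙ c ∣) * M         ≡⟨ *-distribʳ-+ M ℤ.∣ i ℤ.* j ∣ _ ⟩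
  ℤ.∣ i ℤ.* j ∣ * M + ℤ.∣ y ∙ c ∣ * M       ≡⟨ cong (λ x → x * M + ℤ.∣ y ∙ c ∣ * M) (ℤ.abs-* i j) ⟩
  ℤ.∣ i ∣ * ℤ.∣ j ∣ * M + ℤ.∣ y ∙ c ∣ * M   ≡⟨ cong (λ x → x + ℤ.∣ y ∙ c ∣ * M) (swap ℤ.∣ i ∣ ℤ.∣ j ∣ M) ⟩
  ℤ.∣ i ∣ * M * ℤ.∣ j ∣ + ℤ.∣ y ∙ c ∣ * M   ≤⟨ +-mono-≤ (*-mono-≤ i≤ j≤) (small-dot y c y≤ c≤) ⟩
  a * b + N * (a * b)                       ∎
  where
  open ≤-Reasoning
  swap : ∀ i j m → i * j * m ≡ i * m * j
  swap = solve-∀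

∣/∣-≤ : ∀ i k m → ℚ.∣ i ℚ./ suc k ∣ ℚ.≤ + 1 ℚ./ suc m → ℤ.∣ i ∣ * suc m ≤ suc k
∣/∣-≤ i k m le = ℤ.drop‿+≤+ (subst₂ ℤ._≤_ (sym (ℤ.pos-* ℤ.∣ i ∣ (suc m))) (ℤ.*-identityˡ (+ suc k)) (ℚᵘ.drop-*≤* (begin
  mkℚᵘ (+ ℤ.∣ i ∣) k              ≃⟨ ℚᵘ.∣-∣-cong (toℚᵘ-/ i k) ⟨
  ℚᵘ.∣ ℚ.toℚᵘ (i ℚ./ suc k) ∣     ≃⟨ ℚ.toℚᵘ-homo-∣-∣ (i ℚ./ suc k) ⟨
  ℚ.toℚᵘ ℚ.∣ i ℚ./ suc k ∣        ≤⟨ ℚ.toℚᵘ-mono-≤ le ⟩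
  ℚ.toℚᵘ (+ 1 ℚ./ suc m)          ≃⟨ toℚᵘ-/ (+ 1) m ⟩
  mkℚᵘ (+ 1) m                    ∎)))
  where open ℚᵘ.≤-Reasoning

point-entries≤2 : ∀ a e → ℤ.∣ a ∣ ≤ 2 → ℤ.∣ e ∣ ≤ 2 → (C : Subset d) → Vecᴬ.All (λ i → ℤ.∣ i ∣ ≤ 2) (point a e C)
point-entries≤2 a e a≤2 e≤2 []          = e≤2 Vecᴬ.∷ Vecᴬ.[]
point-entries≤2 a e a≤2 e≤2 (true ∷ C)  = subst (λ i → ℤ.∣ i ∣ ≤ 2) (sym (ℤ.*-identityʳ a)) a≤2
  Vecᴬ.∷ point-entries≤2 a e a≤2 e≤2 C
point-entries≤2 a e a≤2 e≤2 (false ∷ C) = subst (λ i → ℤ.∣ i ∣ ≤ 2) (sym (ℤ.*-zeroʳ a)) z≤n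
  Vecᴬ.∷ point-entries≤2 a e a≤2 e≤2 C

module _ (G₁ G₂ : SimpleGraph d) where

  DualPoint-entries≤2 : ∀ q → DualPoint G₁ G₂ q → Vecᴬ.All (λ i → ℤ.∣ i ∣ ≤ 2) q
  DualPoint-entries≤2 q (inj₁ (C , _ , refl)) = point-entries≤2 (+ 2) (ℤ.- (+ 1)) ≤-refl (s≤s z≤n) C
  DualPoint-entries≤2 q (inj₂ (C , _ , refl)) = point-entries≤2 (ℤ.- (+ 2)) (+ 1) ≤-refl (s≤s z≤n) C

  weightedPerfect⇒originInterior : WeightedPerfect (Stable G₁) (Clique G₁) → WeightedPerfect (Stable G₂) (Clique G₂) →
    OriginInterior (ΩGen G₁ G₂)
  weightedPerfect⇒originInterior perfect₁ perfect₂ =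
    -- The radius is 1/(2(d + 1)): a dual point has d + 1 entries of absolute value at most 2, so it
    -- pairs to at most 1 with every point of this cube.
    + 1 ℚ./ suc (d + suc d) , ℚ.positive⁻¹ _ {{ℚ.normalize-pos 1 (suc (d + suc d))}} , ball
    where
    ball : ∀ x → Vecᴬ.All (λ xᵢ → ℚ.∣ xᵢ ∣ ℚ.≤ + 1 ℚ./ suc (d + suc d)) x → InConv (ΩGen G₁ G₂) x
    ball x x≤ε with commonDenominator x
    ... | k , y , refl with Vec.initLast y
    ... | z , h , refl = halfSpaces⇒conv G₁ G₂ perfect₁ perfect₂ k z h (dual⇒halfSpaces G₁ G₂ (+ suc k) z h bound)
      where
      scaled : Vecᴬ.All (λ i → ℤ.∣ i ∣ * (suc d + suc d) ≤ suc k) (z ∷ʳ h)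
      scaled = Vecᴬ.map (λ {i} → ∣/∣-≤ i k (d + suc d)) (Vecᴬ.map⁻ x≤ε)
      swap : ∀ n k → n * (k * 2) ≡ k * (n + n)
      swap = solve-∀
      bound : ∀ q → DualPoint G₁ G₂ q → (z ∷ʳ h) ∙ q ℤ.≤ + suc k
      bound q Dq = ℤ.≤-trans (i≤+∣i∣ _) (ℤ.+≤+ (*-cancelʳ-≤ _ _ (suc d + suc d)
        (≤-trans (small-dot (z ∷ʳ h) q scaled (DualPoint-entries≤2 q Dq)) (≤-reflexive (swap (suc d) (suc k))))))

  -- Polar counterpart of `halfSpaces⇒conv`, with cliques and stable sets exchanged. With n = k + 1,
  -- the numbers r = n - t and s = n + t are nonnegative by the empty stable sets; moreover r + s =
  -- 2n and -(r - s) = 2t.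
  bounded⇒dualConv : WeightedPerfect (Clique G₁) (Stable G₁) → WeightedPerfect (Clique G₂) (Stable G₂) →
    ∀ k z t → (∀ p → ΩGen G₁ G₂ p → (z ∷ʳ t) ∙ p ℤ.≤ + suc k) → InConv (DualPoint G₁ G₂) ((z ∷ʳ t) ÷suc k)
  bounded⇒dualConv perfect₁ perfect₂ k z t bound = build (nonneg-nat nonneg₁) (nonneg-nat nonneg₂)
    where
    stable₁ : ∀ W → Stable G₁ W → z ∙ ρ W ℤ.≤ + suc k ℤ.- t
    stable₁ W st = ≤-by (eq (+ suc k) t (z ∙ ρ W))
      (subst (ℤ._≤ + suc k) (∷ʳ-∙-point z t (+ 1) (+ 1) W) (bound _ (point⇒Ω G₁ G₂ (inj₁ (W , st , refl)))))
      where
      eq : ∀ n t x → n ℤ.- (+ 1 ℤ.* x ℤ.+ t ℤ.* + 1) ≡ n ℤ.- t ℤ.- x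
      eq = solveℤ
    stable₂ : ∀ W → Stable G₂ W → ℤ.- (z ∙ ρ W) ℤ.≤ + suc k ℤ.+ t
    stable₂ W st = ≤-by (eq (+ suc k) t (z ∙ ρ W))
      (subst (ℤ._≤ + suc k) (∷ʳ-∙-point z t (ℤ.- (+ 1)) (ℤ.- (+ 1)) W) (bound _ (point⇒Ω G₁ G₂ (inj₂ (W , st , refl)))))
      where
      eq : ∀ n t x → n ℤ.- (ℤ.- (+ 1) ℤ.* x ℤ.+ t ℤ.* ℤ.- (+ 1)) ≡ n ℤ.+ t ℤ.- ℤ.- x
      eq = solveℤ
    nonneg₁ : + 0 ℤ.≤ + suc k ℤ.- t
    nonneg₁ = subst (ℤ._≤ _) (∙-ρ-∅ z) (stable₁ ∅ (Stable-∅ G₁))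
    nonneg₂ : + 0 ℤ.≤ + suc k ℤ.+ t
    nonneg₂ = subst (ℤ._≤ _) (cong ℤ.-_ (∙-ρ-∅ z)) (stable₂ ∅ (Stable-∅ G₂))
    eq₁ : ∀ n t → n ℤ.- t ℤ.+ (n ℤ.+ t) ≡ n ℤ.+ n
    eq₁ = solveℤ
    eq₂ : ∀ n t → ℤ.- (+ 1) ℤ.* (n ℤ.- t ℤ.- (n ℤ.+ t)) ≡ t ℤ.+ t
    eq₂ = solveℤ
    build : (∃ λ r → + suc k ℤ.- t ≡ + r) → (∃ λ s → + suc k ℤ.+ t ≡ + s) → InConv (DualPoint G₁ G₂) ((z ∷ʳ t) ÷suc k)
    build (r , r≡) (s , s≡)
      with signed-decomposition perfect₁ perfect₂ (λ {S} {T} → Stable-down G₁ {S} {T}) (λ {S} {T} → Stable-down G₂ {S} {T})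
             (+ 2) (ℤ.- (+ 1)) z r s
             (λ W st → subst (z ∙ ρ W ℤ.≤_) r≡ (stable₁ W st)) (λ W st → subst (ℤ.- (z ∙ ρ W) ℤ.≤_) s≡ (stable₂ W st))
    ... | ps , Dps , len , sum≡ = average-of-doubles∈conv (z ∷ʳ t) ps Dps
      (trans len (ℤ.+-injective (trans (cong₂ ℤ._+_ (sym r≡) (sym s≡)) (eq₁ (+ suc k) t))))
      (trans sum≡ (trans (cong₂ _∷ʳ_ (double z)
        (trans (cong₂ (λ x y → ℤ.- (+ 1) ℤ.* (x ℤ.- y)) (sym r≡) (sym s≡)) (eq₂ (+ suc k) t)))
        (sym (⊞-∷ʳ z z t t))))

  -- `Reflexive` asks for an explicit finite list of lattice points spanning the polar.
  dualPoints : List (Vec ℤ (suc d))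
  dualPoints = List.map (point (+ 2) (ℤ.- (+ 1))) (List.filter (Clique? G₁) (subsets d)) ++
               List.map (point (ℤ.- (+ 2)) (+ 1)) (List.filter (Clique? G₂) (subsets d))

  ∈-dualPoints⁺ : ∀ {q} → DualPoint G₁ G₂ q → q ∈ˡ dualPoints
  ∈-dualPoints⁺ (inj₁ (C , cl , refl)) = ∈ˡ.∈-++⁺ˡ (∈ˡ.∈-map⁺ _ (∈ˡ.∈-filter⁺ (Clique? G₁) (∈-subsets C) cl))
  ∈-dualPoints⁺ (inj₂ (C , cl , refl)) = ∈ˡ.∈-++⁺ʳ _ (∈ˡ.∈-map⁺ _ (∈ˡ.∈-filter⁺ (Clique? G₂) (∈-subsets C) cl))

  ∈-dualPoints⁻ : ∀ {q} → q ∈ˡ dualPoints → DualPoint G₁ G₂ q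
  ∈-dualPoints⁻ q∈ with ∈ˡ.∈-++⁻ (List.map (point (+ 2) (ℤ.- (+ 1))) (List.filter (Clique? G₁) (subsets d))) q∈
  ... | inj₁ q∈₁ = let C , C∈ , eq = ∈ˡ.∈-map⁻ _ q∈₁ in inj₁ (C , proj₂ (∈ˡ.∈-filter⁻ (Clique? G₁) {xs = subsets d} C∈) , eq)
  ... | inj₂ q∈₂ = let C , C∈ , eq = ∈ˡ.∈-map⁻ _ q∈₂ in inj₂ (C , proj₂ (∈ˡ.∈-filter⁻ (Clique? G₂) {xs = subsets d} C∈) , eq)

  -- The pairing is bilinear, so `conv-≤` reduces each argument in turn to generators.
  dualConv⇒InDual : ∀ x → InConv (DualPoint G₁ G₂) x → InDual (ΩGen G₁ G₂) x
  dualConv⇒InDual x x∈ y y∈ = conv-≤ y 1ℚ (λ q Dq → subst (ℚ._≤ 1ℚ) (dotℚ-comm y (toℚ q))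
    (conv-≤ (toℚ q) 1ℚ (λ p Ωp → subst (ℚ._≤ 1ℚ) (sym (dot-÷ p q 0))
      (/-mono-≤ {p ∙ q} {+ 1} {0} {0} (ℤ.*-monoʳ-≤-nonNeg (+ 1) (pairing≤1 G₁ G₂ p q Ωp Dq)))) y∈)) x∈

  InDual⇒dualConv : WeightedPerfect (Clique G₁) (Stable G₁) → WeightedPerfect (Clique G₂) (Stable G₂) →
    ∀ x → InDual (ΩGen G₁ G₂) x → InConv (DualPoint G₁ G₂) x
  InDual⇒dualConv perfect₁ perfect₂ x x∈ with commonDenominator x
  ... | k , y , refl with Vec.initLast y
  ... | z , t , refl = bounded⇒dualConv perfect₁ perfect₂ k z t λ p Ωp →
    subst₂ ℤ._≤_ (ℤ.*-identityʳ _) (ℤ.*-identityˡ (+ suc k)) (/-cancel-≤ {(z ∷ʳ t) ∙ p} {+ 1} {k} {0}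
      (subst (ℚ._≤ 1ℚ) (dot-÷ (z ∷ʳ t) p k) (x∈ (toℚ p) (generator∈conv Ωp))))

  perfect⇒reflexive : Perfect G₁ → Perfect G₂ → Reflexive (ΩGen G₁ G₂)
  perfect⇒reflexive perfect₁ perfect₂ =
    weightedPerfect⇒originInterior (perfect⇒weightedPerfect G₁ perfect₁) (perfect⇒weightedPerfect G₂ perfect₂) ,
    _ , Vec.fromList dualPoints , λ x → mk⇔
      (InConv-mono (∈ᵛ.∈-fromList⁺ ∘ ∈-dualPoints⁺) ∘
        InDual⇒dualConv (perfect⇒weightedPerfect-dual G₁ perfect₁) (perfect⇒weightedPerfect-dual G₂ perfect₂) x)
      (dualConv⇒InDual x ∘ InConv-mono (∈-dualPoints⁻ ∘ ∈ᵛ.∈-fromList⁻))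

-- Perfection from halving

_-ᵛ_ : Subset d → Fin d → Subset d
S -ᵛ v = S ∩ ∁ ⁅ v ⁆

⊆⇒∩≡ : {S T : Subset d} → T ⊆ S → S ∩ T ≡ T
⊆⇒∩≡ {S = S} {T} T⊆S = ⊆-antisym (p∩q⊆q S T) λ i∈ → x∈p∩q⁺ (T⊆S i∈ , i∈)

𝟙-minus : {S T : Subset d} → T ⊆ S → 𝟙 S ≡ 𝟙 T ⊕ 𝟙 (S ∩ ∁ T)
𝟙-minus {S = S} {T} T⊆S = trans (𝟙-split S T) (cong (λ U → 𝟙 U ⊕ 𝟙 (S ∩ ∁ T)) (⊆⇒∩≡ T⊆S))

dot-𝟙-⊤ : (S : Subset d) → ⟪ 𝟙 S , 𝟙 ⊤ ⟫ ≡ ∣ S ∣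
dot-𝟙-⊤ []          = refl
dot-𝟙-⊤ (true ∷ S)  = cong suc (dot-𝟙-⊤ S)
dot-𝟙-⊤ (false ∷ S) = dot-𝟙-⊤ S

card-minus : {S T : Subset d} → T ⊆ S → ∣ S ∣ ≡ ∣ T ∣ + ∣ S ∩ ∁ T ∣
card-minus {S = S} {T} T⊆S = trans (sym (dot-𝟙-⊤ S)) (trans (cong (λ w → ⟪ w , 𝟙 ⊤ ⟫) (𝟙-minus T⊆S))
  (trans (dot-⊕ˡ (𝟙 T) (𝟙 (S ∩ ∁ T)) (𝟙 ⊤)) (cong₂ _+_ (dot-𝟙-⊤ T) (dot-𝟙-⊤ (S ∩ ∁ T)))))

𝟙-pair : {i j : Fin d} → i ≢ j → 𝟙 (⁅ i ⁆ ∪ ⁅ j ⁆) ≡ 𝟙 ⁅ i ⁆ ⊕ 𝟙 ⁅ j ⁆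
𝟙-pair {i = i} {j} i≢j = trans (𝟙-minus (p⊆p∪q ⁅ j ⁆)) (cong (λ U → 𝟙 ⁅ i ⁆ ⊕ 𝟙 U) (⊆-antisym to from))
  where
  to : (⁅ i ⁆ ∪ ⁅ j ⁆) ∩ ∁ ⁅ i ⁆ ⊆ ⁅ j ⁆
  to x∈ with x∈p∩q⁻ (⁅ i ⁆ ∪ ⁅ j ⁆) (∁ ⁅ i ⁆) x∈
  ... | x∈∪ , x∈∁ = [ (λ x∈i → contradiction x∈i (x∈∁p⇒x∉p x∈∁)) , id ]′ (x∈p∪q⁻ ⁅ i ⁆ ⁅ j ⁆ x∈∪)
  from : ⁅ j ⁆ ⊆ (⁅ i ⁆ ∪ ⁅ j ⁆) ∩ ∁ ⁅ i ⁆
  from x∈ = x∈p∩q⁺ (x∈p∪q⁺ (inj₂ x∈) , x∉p⇒x∈∁p λ x∈i →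
    i≢j (trans (sym (x∈⁅y⁆⇒x≡y i x∈i)) (x∈⁅y⁆⇒x≡y j x∈)))

pair-card : {i j : Fin d} → i ≢ j → ∣ ⁅ i ⁆ ∪ ⁅ j ⁆ ∣ ≡ 2
pair-card {i = i} {j} i≢j = trans (sym (dot-𝟙-⊤ (⁅ i ⁆ ∪ ⁅ j ⁆))) (trans (cong (λ w → ⟪ w , 𝟙 ⊤ ⟫) (𝟙-pair i≢j))
  (trans (dot-⊕ˡ (𝟙 ⁅ i ⁆) (𝟙 ⁅ j ⁆) (𝟙 ⊤))
    (cong₂ _+_ (trans (dot-𝟙-⊤ ⁅ i ⁆) (∣⁅x⁆∣≡1 i)) (trans (dot-𝟙-⊤ ⁅ j ⁆) (∣⁅x⁆∣≡1 j)))))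

pair-E : (G : SimpleGraph d) (i j : Fin d) {b : Bool} → E G i j ≡ b →
  ∀ x y → x ∈ ⁅ i ⁆ ∪ ⁅ j ⁆ → y ∈ ⁅ i ⁆ ∪ ⁅ j ⁆ → x ≢ y → E G x y ≡ b
pair-E G i j ij x y x∈ y∈ x≢y with x∈p∪q⁻ ⁅ i ⁆ ⁅ j ⁆ x∈ | x∈p∪q⁻ ⁅ i ⁆ ⁅ j ⁆ y∈
... | inj₁ x∈i | inj₁ y∈i = contradiction (⁅⁆-trivial G i x∈i y∈i) x≢y
... | inj₂ x∈j | inj₂ y∈j = contradiction (⁅⁆-trivial G j x∈j y∈j) x≢y
... | inj₁ x∈i | inj₂ y∈j = trans (cong₂ (E G) (x∈⁅y⁆⇒x≡y i x∈i) (x∈⁅y⁆⇒x≡y j y∈j)) ij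
... | inj₂ x∈j | inj₁ y∈i = trans (cong₂ (E G) (x∈⁅y⁆⇒x≡y j x∈j) (x∈⁅y⁆⇒x≡y i y∈i)) (trans (E-sym G j i) ij)

infixr 7 _·_
_·_ : ℕ → Weight d → Weight d
zero  · w = 𝟎
suc m · w = w ⊕ m · w

·-distrib-+ : ∀ m n (w : Weight d) → (m + n) · w ≡ m · w ⊕ n · w
·-distrib-+ zero    n w = sym (⊕-identityˡ _)
·-distrib-+ (suc m) n w = trans (cong (w ⊕_) (·-distrib-+ m n w)) (sym (⊕-assoc w _ _))

decomposition-· : {A : SetFamily d} {s : ℕ} {w : Weight d} → ∀ m → Decomposition A s w → Decomposition A (m * s) (m · w)
decomposition-· zero    D = decomposition-𝟎
decomposition-· (suc m) D = decomposition-⊕ D (decomposition-· m D)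

-- The form in which the decomposition property enters: it permits rounding (2k + 1)/2 down to `k`.
Halving : SetFamily d → Set
Halving A = ∀ k w → Decomposition A (suc (k + k)) (w ⊕ w) → Decomposition A k w

-- Each halving replaces `L` by (L - 1)/2, that is, it halves L + 1; hence the hypothesis in terms
-- of `suc L` and `suc k`.
halving-2^ : {A : SetFamily d} → Halving A → ∀ t {L} k w → suc L ≡ 2 ^ t * suc k →
  Decomposition A L ((2 ^ t) · w) → Decomposition A k w
halving-2^ halving zero {L} k w L≡ D =
  subst₂ (Decomposition _) (suc-injective (trans L≡ (*-identityˡ (suc k)))) (⊕-identityʳ w) D
halving-2^ halving (suc t) {L} k w L≡ D with 2 ^ t * suc k in 2^t*k
... | zero  = contradiction 2^t*k (>⇒≢ (*-mono-≤ (m^n>0 2 t) (s≤s z≤n)))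
... | suc M = halving-2^ halving t k w (sym 2^t*k) (halving M ((2 ^ t) · w)
  (subst₂ (Decomposition _) L≡M
    (trans (cong (λ p → p · w) (cong (λ x → 2 ^ t + x) (+-identityʳ (2 ^ t)))) (·-distrib-+ (2 ^ t) (2 ^ t) w)) D))
  where
  assoc : ∀ p k → 2 * p * k ≡ p * k + p * k
  assoc = solve-∀
  L≡M : L ≡ suc (M + M)
  L≡M = suc-injective (trans L≡ (trans (assoc (2 ^ t) (suc k)) (trans (cong₂ _+_ 2^t*k 2^t*k) (cong suc (+-suc M M)))))

⊕-interchange : (u v w x : Weight d) → u ⊕ v ⊕ (w ⊕ x) ≡ u ⊕ w ⊕ (v ⊕ x)
⊕-interchange u v w x = trans (⊕-assoc u v (w ⊕ x)) (trans (cong (u ⊕_) (⊕-swap v w x)) (sym (⊕-assoc u w (v ⊕ x))))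

n≤2^n : ∀ n → n ≤ 2 ^ n
n≤2^n zero    = z≤n
n≤2^n (suc n) = ≤-trans (+-mono-≤ (m^n>0 2 n) (n≤2^n n)) (≤-reflexive (cong (λ x → 2 ^ n + x) (sym (+-identityʳ (2 ^ n)))))

module _ (G : SimpleGraph d) (halving : Halving (Stable G)) where

  private
    D : ℕ → Weight d → Set
    D = Decomposition (Stable G)

  -- With |S| = n + 1, the covers of all S -ᵛ v add up to n copies of S, using (n + 1)k < n(k + 1) sets.
  average-deletions : ∀ S n k → ∣ S ∣ ≡ suc n → suc k ≤ n → (∀ v → v ∈ S → D k (𝟙 (S -ᵛ v))) → D k (𝟙 S)
  average-deletions S (suc n) k card (s≤s k≤n) covers with vertices S
  ... | [] , _ , len , _ = contradiction (trans len card) λ()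
  -- Halving handles powers of two, so the `suc n` copies of `S` are filled up to `2 ^ suc n` by `j`
  -- more, each covered by `suc k` sets. The total stays below `2 ^ suc n * suc k`.
  ... | vs@(v ∷ _) , vs⊆S@(v∈S ∷ _) , len , total≡ with m≤n⇒∃[o]m+o≡n (n≤2^n (suc n))
  ... | j , n+j≡ = halving-2^ halving (suc n) k (𝟙 S) (trans (count n j k) (cong (_* suc k) n+j≡))
    (subst (D _) (trans (sym (·-distrib-+ (suc n) j (𝟙 S))) (cong (_· 𝟙 S) n+j≡))
      (decomposition-pad (Stable-∅ G) padded (decomposition-⊕ averaged (decomposition-· j cover))))
    where
    count : ∀ n j k → suc (n + suc n * k + j * suc k) ≡ (suc n + j) * suc k
    count = solve-∀
    padded : suc (suc n) * k + j * suc k ≤ n + suc n * k + j * suc k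
    padded = +-monoˡ-≤ (j * suc k) (+-monoˡ-≤ (suc n * k) k≤n)
    -- `v` takes a colour of its own.
    cover : D (suc k) (𝟙 S)
    cover = subst (D (suc k)) (sym (𝟙-minus (⁅⁆⊆ v∈S))) (decomposition-⊕ (decomposition-𝟙 (Stable-⁅⁆ G v)) (covers v v∈S))
    sweep : ∀ us → All (_∈ S) us → ∃ λ u → D (length us * k) u × total (List.map ⁅_⁆ us) ⊕ u ≡ length us · 𝟙 S
    sweep [] [] = 𝟎 , decomposition-𝟎 , ⊕-identityˡ 𝟎
    sweep (w ∷ us) (w∈S ∷ us⊆S) with sweep us us⊆S
    ... | u , Du , eq = 𝟙 (S -ᵛ w) ⊕ u , decomposition-⊕ (covers w w∈S) Du ,
      trans (⊕-interchange (𝟙 ⁅ w ⁆) _ (𝟙 (S -ᵛ w)) u) (cong₂ _⊕_ (sym (𝟙-minus (⁅⁆⊆ w∈S))) eq)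
    -- Singletons and covers together make one copy of `S` for each vertex; the singletons alone
    -- make up one copy, which is cancelled.
    averaged : D (suc (suc n) * k) (suc n · 𝟙 S)
    averaged with sweep vs vs⊆S
    ... | u , Du , eq = subst₂ D (cong (_* k) (trans len card))
      (⊕-cancelˡ (𝟙 S) (trans (cong (_⊕ u) (sym total≡)) (trans eq (cong (_· 𝟙 S) (trans len card))))) Du

  -- Two non-adjacent vertices share a colour and every other vertex has its own.
  nonClique-decomposition : ∀ S n → ∣ S ∣ ≡ suc n → ∀ {i j} → i ∈ S → j ∈ S → i ≢ j → E G i j ≡ false → D n (𝟙 S)
  nonClique-decomposition S n card {i} {j} i∈S j∈S i≢j ij∉E with vertices (S ∩ ∁ (⁅ i ⁆ ∪ ⁅ j ⁆))
  ... | vs , _ , len , total≡ = subst₂ D count (sym (𝟙-minus pair⊆S))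
    (decomposition-⊕ (decomposition-𝟙 (pair-E G i j ij∉E))
      (List.map ⁅_⁆ vs , refl , All.map⁺ (All.universal (Stable-⁅⁆ G) vs) , total≡))
    where
    pair⊆S : ⁅ i ⁆ ∪ ⁅ j ⁆ ⊆ S
    pair⊆S x∈ = [ ⁅⁆⊆ i∈S , ⁅⁆⊆ j∈S ]′ (x∈p∪q⁻ ⁅ i ⁆ ⁅ j ⁆ x∈)
    count : suc (length (List.map ⁅_⁆ vs)) ≡ n
    count = suc-injective (trans (cong (λ x → 2 + x) (trans (length-map ⁅_⁆ vs) len))
      (trans (cong (λ x → x + ∣ S ∩ ∁ (⁅ i ⁆ ∪ ⁅ j ⁆) ∣) (sym (pair-card i≢j))) (trans (sym (card-minus pair⊆S)) card)))

  clique-or-nonEdge : ∀ S → Clique G S ⊎ (∃₂ λ i j → i ∈ S × j ∈ S × i ≢ j × E G i j ≡ false)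
  clique-or-nonEdge S
    with Fin.any? (λ i → Fin.any? λ j → i ∈? S ×-dec j ∈? S ×-dec ¬? (i Fin.≟ j) ×-dec E G i j ≟ᵇ false)
  ... | yes nonEdge = inj₂ nonEdge
  ... | no ¬nonEdge = inj₁ clique
    where
    clique : Clique G S
    clique i j i∈S j∈S i≢j with E G i j in eq
    ... | true  = refl
    ... | false = contradiction (i , j , i∈S , j∈S , i≢j , eq) ¬nonEdge

  -- The inequality χ ≤ ω with witnesses, by induction on the size of `S`.
  clique-decomposition : ∀ S → ∃ λ K → K ⊆ S × Clique G K × D ∣ K ∣ (𝟙 S)
  clique-decomposition S = go _ S refl
    where
    Good : Subset d → Set
    Good S = ∃ λ K → K ⊆ S × Clique G K × D ∣ K ∣ (𝟙 S)

    go : ∀ n S → ∣ S ∣ ≡ n → Good S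

    -- The largest among the cliques found for the sets `S -ᵛ v`: its size is a number of stable
    -- sets that suffices for all deletions at once.
    largest : ∀ n S → ∣ S ∣ ≡ suc n → ∀ vs → All (_∈ S) vs →
      ∃ λ K → K ⊆ S × Clique G K × All (λ v → D ∣ K ∣ (𝟙 (S -ᵛ v))) vs

    go zero S card with vertices S
    ... | [] , _ , _ , total≡ = ∅ , (λ {_} → ⊥⊆) , Clique-∅ G ,
      subst₂ D (sym (∣⊥∣≡0 d)) total≡ decomposition-𝟎
    ... | _ ∷ _ , _ , len , _ = contradiction (trans len card) λ()
    -- Filtering the list of all vertices guarantees that every element of `S` occurs, as
    -- `average-deletions` needs.
    go (suc n) S card with largest n S card (List.filter (_∈? S) (List.allFin d)) (All.all-filter (_∈? S) (List.allFin d))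
    ... | K , K⊆S , clK , DK with suc ∣ K ∣ ≤? n
    ... | yes K<n = K , (λ {_} → K⊆S) , clK , average-deletions S n ∣ K ∣ card K<n
      λ v v∈S → All.lookup DK (∈ˡ.∈-filter⁺ (_∈? S) (∈ˡ.∈-allFin v) v∈S)
    -- Now `n ≤ ∣ K ∣`: a non-edge saves one of the `suc n` colours, and without a non-edge `S`
    -- itself is the clique.
    ... | no  K≮n with clique-or-nonEdge S
    ... | inj₂ (i , j , i∈S , j∈S , i≢j , ij∉E) = K , (λ {_} → K⊆S) , clK ,
      decomposition-pad (Stable-∅ G) (s≤s⁻¹ (≰⇒> K≮n)) (nonClique-decomposition S n card i∈S j∈S i≢j ij∉E)
    ... | inj₁ clS with vertices S
    ... | vs , _ , len , total≡ = S , (λ {_} → id) , clS , List.map ⁅_⁆ vs , trans (length-map ⁅_⁆ vs) len ,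
      All.map⁺ (All.universal (Stable-⁅⁆ G) vs) , total≡

    largest n S card [] [] = ∅ , (λ {_} → ⊥⊆) , Clique-∅ G , []
    largest n S card (v ∷ vs) (v∈S ∷ vs⊆S)
      with largest n S card vs vs⊆S | go n (S -ᵛ v) (suc-injective (trans (cong (λ x → x + ∣ S -ᵛ v ∣) (sym (∣⁅x⁆∣≡1 v)))
                                                       (trans (sym (card-minus (⁅⁆⊆ v∈S))) card)))
    ... | K , K⊆S , clK , DK | J , J⊆ , clJ , DJ with ≤-total ∣ J ∣ ∣ K ∣
    ... | inj₁ J≤K = K , (λ {_} → K⊆S) , clK , decomposition-pad (Stable-∅ G) J≤K DJ ∷ DK
    ... | inj₂ K≤J = J , (λ {_} x∈ → p∩q⊆p S (∁ ⁅ v ⁆) (J⊆ x∈)) , clJ , DJ ∷ All.map (decomposition-pad (Stable-∅ G) K≤J) DK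

  -- `clique-decomposition` gives χ ≤ ω; conversely ω ≤ χ because a colour class meets a clique at
  -- most once.
  halving⇒perfect : Perfect G
  halving⇒perfect S χ ω (colouring , minimal) ((K′ , K′⊆S , clK′ , refl) , maximal)
    with clique-decomposition S | colouring⇒decomposition G χ S colouring
  ... | K , K⊆S , clK , DK | Ws , refl , stable , total≡ = ≤-antisym
    (≤-trans (minimal ∣ K ∣ (decomposition⇒colouring G DK)) (maximal K K⊆S clK))
    (begin
      ∣ K′ ∣                ≤⟨ card≤dot K′⊆S ⟩
      ⟪ 𝟙 S , 𝟙 K′ ⟫        ≡⟨ dot-comm (𝟙 S) (𝟙 K′) ⟩
      ⟪ 𝟙 K′ , 𝟙 S ⟫        ≡⟨ cong ⟪ 𝟙 K′ ,_⟫ total≡ ⟨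
      ⟪ 𝟙 K′ , total Ws ⟫   ≤⟨ dot-total-≤ (𝟙 K′) 1 Ws (All.map (λ {W} st →
                                 subst (_≤ 1) (dot-comm (𝟙 W) (𝟙 K′)) (meet-once G W K′ st clK′)) stable) ⟩
      length Ws * 1         ≡⟨ *-identityʳ _ ⟩
      length Ws             ∎)
    where open ≤-Reasoning

-- Halving from the integer decomposition property

∙-ρ-⁅⁆ : (z : Vec ℤ d) (i : Fin d) → z ∙ ρ ⁅ i ⁆ ≡ lookup z i
∙-ρ-⁅⁆ (a ∷ z) zero    = trans (cong₂ ℤ._+_ (ℤ.*-identityʳ a) (∙-ρ-∅ z)) (ℤ.+-identityʳ a)
∙-ρ-⁅⁆ (a ∷ z) (suc i) = trans (cong₂ ℤ._+_ (ℤ.*-zeroʳ a) (∙-ρ-⁅⁆ z i)) (ℤ.+-identityˡ _)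

map-+-𝟙 : (W : Subset d) → map +_ (𝟙 W) ≡ ρ W
map-+-𝟙 []          = refl
map-+-𝟙 (true ∷ W)  = cong (+ 1 ∷_) (map-+-𝟙 W)
map-+-𝟙 (false ∷ W) = cong (+ 0 ∷_) (map-+-𝟙 W)

map-+-⊕ : (u v : Weight d) → map +_ (u ⊕ v) ≡ map +_ u ⊞ map +_ v
map-+-⊕ []      []      = refl
map-+-⊕ (m ∷ u) (n ∷ v) = cong (+ (m + n) ∷_) (map-+-⊕ u v)

map-+-injective : {u v : Weight d} → map +_ u ≡ map +_ v → u ≡ v
map-+-injective {u = []}    {[]}    _  = refl
map-+-injective {u = _ ∷ _} {_ ∷ _} eq =
  cong₂ _∷_ (ℤ.+-injective (Vec.∷-injectiveˡ eq)) (map-+-injective (Vec.∷-injectiveʳ eq))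

nonneg-≤1 : ∀ a → a ℤ.≤ + 1 → ℤ.- a ℤ.≤ + 0 → a ≢ + 1 → a ≡ + 0
nonneg-≤1 (+ 0)           _ _ _   = refl
nonneg-≤1 (+ 1)           _ _ a≢1 = contradiction refl a≢1
nonneg-≤1 (+ suc (suc _)) (ℤ.+≤+ (s≤s ())) _ _
nonneg-≤1 -[1+ _ ]        _ (ℤ.+≤+ ()) _

module _ (G₁ G₂ : SimpleGraph d) where

  private
    D : ℕ → Weight d → Set
    D = Decomposition (Stable G₁)

  -- δ is the amount by which a sum (x , h) of n lattice points falls short of the maximal height n.
  Slice : ℕ → Vec ℤ d → ℤ → Set
  Slice n x h = ∃ λ δ → h ℤ.+ + δ ≡ + n × (δ ≤ 1 → ∃₂ λ m w → m + δ ≡ n × x ≡ map +_ w × D m w)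

  -- Read off from the half-space inequalities, with `Q`, which is 1 - h, as the shortfall. Heights
  -- 1 and 0 have shortfalls 0 and 1; at height -1 `Slice` demands no shape.
  latticePt⇒slice : ∀ y h → LatticePt (ΩGen G₁ G₂) (y ∷ʳ h) → Slice 1 y h
  latticePt⇒slice y h lat with conv⇒halfSpaces G₁ G₂ 0 y h lat
  ... | half with halfSpaces-height G₁ G₂ (+ 1) y h half
  ... | (P , P≡) , (Q , Q≡) with halfSpaces-≤ G₁ G₂ (+ 1) y h P≡ Q≡ half
  ... | ≤P , ≤Q = Q , trans (cong (λ s → h ℤ.+ s) (sym Q≡)) (eq₁ h) , shape Q P+Q ≤P ≤Q
    where
    eq₁ : ∀ h → h ℤ.+ (+ 1 ℤ.- h) ≡ + 1
    eq₁ = solveℤ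
    eq₂ : ∀ h → + 1 ℤ.+ h ℤ.+ (+ 1 ℤ.- h) ≡ + 2
    eq₂ = solveℤ
    P+Q : P + Q ≡ 2
    P+Q = ℤ.+-injective (trans (cong₂ ℤ._+_ (sym P≡) (sym Q≡)) (eq₂ h))
    shape : ∀ {P} Q → P + Q ≡ 2 → (∀ C → Clique G₁ C → + 2 ℤ.* (y ∙ ρ C) ℤ.≤ + P) →
      (∀ C → Clique G₂ C → + 2 ℤ.* ℤ.- (y ∙ ρ C) ℤ.≤ + Q) →
      Q ≤ 1 → ∃₂ λ m w → m + Q ≡ 1 × y ≡ map +_ w × D m w
    -- At height 1 the one-vertex cliques force coordinates 0 or 1, and the two-vertex cliques make
    -- the support stable.
    shape zero P≡2 ≤P ≤Q _ with trans (sym (+-identityʳ _)) P≡2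
    ... | refl = 1 , 𝟙 W , refl , y≡ , decomposition-𝟙 stable
      where
      One? : Decidable (λ i → lookup y i ≡ + 1)
      One? i = lookup y i ℤ.≟ + 1
      W = ⁅ One? ∣⁆
      ≤1 : ∀ C → Clique G₁ C → y ∙ ρ C ℤ.≤ + 1
      ≤1 C cl = half-≤ (y ∙ ρ C) 1 (ℤ.≤-trans (≤P C cl) (ℤ.+≤+ (n≤1+n 2)))
      ≥0 : ∀ C → Clique G₂ C → ℤ.- (y ∙ ρ C) ℤ.≤ + 0
      ≥0 C cl = half-≤ (ℤ.- (y ∙ ρ C)) 0 (ℤ.≤-trans (≤Q C cl) (ℤ.+≤+ z≤n))
      entry : ∀ i → lookup y i ≡ + lookup (𝟙 W) i
      entry i with i ∈? W
      ... | yes i∈W = trans (∈-⁅∣⁆⁻ One? i∈W) (cong +_ (sym (𝟙-∈ i∈W)))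
      ... | no  i∉W = trans (nonneg-≤1 (lookup y i) (subst (ℤ._≤ + 1) (∙-ρ-⁅⁆ y i) (≤1 ⁅ i ⁆ (Clique-⁅⁆ G₁ i)))
        (subst (λ a → ℤ.- a ℤ.≤ + 0) (∙-ρ-⁅⁆ y i) (≥0 ⁅ i ⁆ (Clique-⁅⁆ G₂ i))) (i∉W ∘ ∈-⁅∣⁆⁺ One?)) (cong +_ (sym (𝟙-∉ i∉W)))
      y≡ : y ≡ map +_ (𝟙 W)
      y≡ = lookup-ext λ i → trans (entry i) (sym (Vec.lookup-map i +_ (𝟙 W)))
      stable : Stable G₁ W
      stable i j i∈W j∈W i≢j with E G₁ i j in edge
      ... | false = refl
      ... | true  = contradiction (begin
        2                                  ≡⟨ pair-card i≢j ⟨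
        ∣ ⁅ i ⁆ ∪ ⁅ j ⁆ ∣                  ≤⟨ card≤dot pair⊆W ⟩
        ⟪ 𝟙 W , 𝟙 (⁅ i ⁆ ∪ ⁅ j ⁆) ⟫        ≤⟨ ℤ.drop‿+≤+ (subst (ℤ._≤ + 1) y∙C (≤1 _ (pair-E G₁ i j edge))) ⟩
        1                                  ∎) λ { (s≤s ()) }
        where
        open ≤-Reasoning
        pair⊆W : ⁅ i ⁆ ∪ ⁅ j ⁆ ⊆ W
        pair⊆W x∈ = [ ⁅⁆⊆ i∈W , ⁅⁆⊆ j∈W ]′ (x∈p∪q⁻ ⁅ i ⁆ ⁅ j ⁆ x∈)
        y∙C : y ∙ ρ (⁅ i ⁆ ∪ ⁅ j ⁆) ≡ + ⟪ 𝟙 W , 𝟙 (⁅ i ⁆ ∪ ⁅ j ⁆) ⟫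
        y∙C = trans (cong (_∙ ρ (⁅ i ⁆ ∪ ⁅ j ⁆)) (trans y≡ (map-+-𝟙 W))) (∙-ρ-ρ W (⁅ i ⁆ ∪ ⁅ j ⁆))
    -- At height 0 twice each coordinate lies between -1 and 1, so the coordinate is 0.
    shape (suc zero) P+1≡2 ≤P ≤Q _ with +-cancelʳ-≡ 1 _ 1 P+1≡2
    ... | refl = 0 , 𝟎 , refl , y≡ , decomposition-𝟎
      where
      entry : ∀ i → lookup y i ≡ + 0
      entry i = ℤ.≤-antisym (subst (ℤ._≤ + 0) (∙-ρ-⁅⁆ y i) (half-≤ (y ∙ ρ ⁅ i ⁆) 0 (≤P ⁅ i ⁆ (Clique-⁅⁆ G₁ i))))
        (≤-by (neg (lookup y i))
          (subst (λ a → ℤ.- a ℤ.≤ + 0) (∙-ρ-⁅⁆ y i) (half-≤ (ℤ.- (y ∙ ρ ⁅ i ⁆)) 0 (≤Q ⁅ i ⁆ (Clique-⁅⁆ G₂ i)))))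
        where
        neg : ∀ a → + 0 ℤ.- ℤ.- a ≡ a ℤ.- + 0
        neg = solveℤ
      y≡ : y ≡ map +_ 𝟎
      y≡ = lookup-ext λ i → trans (entry i) (sym (trans (Vec.lookup-map i +_ 𝟎) (cong +_ (Vec.lookup-replicate i 0))))
    shape (suc (suc _)) _ _ _ (s≤s ())

  -- Shortfalls add, and a sum of at most 1 keeps both within the range where the shapes are known.
  slice-⊞ : ∀ {n n′ x x′ h h′} → Slice n x h → Slice n′ x′ h′ → Slice (n + n′) (x ⊞ x′) (h ℤ.+ h′)
  slice-⊞ {n} {n′} {h = h} {h′} (δ , h+δ , f) (δ′ , h′+δ′ , f′) = δ + δ′ ,
    trans (eq h h′ (+ δ) (+ δ′)) (cong₂ ℤ._+_ h+δ h′+δ′) ,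
    λ δ+δ′≤1 → combine (f (≤-trans (m≤m+n δ δ′) δ+δ′≤1)) (f′ (≤-trans (m≤n+m δ′ δ) δ+δ′≤1))
    where
    eq : ∀ a b c e → a ℤ.+ b ℤ.+ (c ℤ.+ e) ≡ a ℤ.+ c ℤ.+ (b ℤ.+ e)
    eq = solveℤ
    combine : ∀ {x x′} → (∃₂ λ m w → m + δ ≡ n × x ≡ map +_ w × D m w) → (∃₂ λ m w → m + δ′ ≡ n′ × x′ ≡ map +_ w × D m w) →
      ∃₂ λ m w → m + (δ + δ′) ≡ n + n′ × x ⊞ x′ ≡ map +_ w × D m w
    combine (m , w , m+δ , refl , Dw) (m′ , w′ , m′+δ′ , refl , Dw′) = m + m′ , w ⊕ w′ ,
      trans (+-interchange m m′ δ δ′) (cong₂ _+_ m+δ m′+δ′) , sym (map-+-⊕ w w′) , decomposition-⊕ Dw Dw′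

  slice-sum : ∀ {n} (as : Vec (Vec ℤ (suc d)) n) → Vecᴬ.All (LatticePt (ΩGen G₁ G₂)) as →
    ∃₂ λ x h → Vec.foldr _ (zipWith ℤ._+_) (Vec.replicate _ (+ 0)) as ≡ x ∷ʳ h × Slice n x h
  slice-sum [] Vecᴬ.[] = map +_ 𝟎 , + 0 , zeros d , 0 , refl , λ _ → 0 , 𝟎 , refl , refl , decomposition-𝟎
    where
    zeros : ∀ d → Vec.replicate (suc d) (+ 0) ≡ map +_ (𝟎 {d}) ∷ʳ + 0
    zeros zero    = refl
    zeros (suc d) = cong (+ 0 ∷_) (zeros d)
  slice-sum (a ∷ as) (lat Vecᴬ.∷ lats) with Vec.initLast a | slice-sum as lats
  ... | y , g , refl | x , h , eq , sl = y ⊞ x , g ℤ.+ h , trans (cong ((y ∷ʳ g) ⊞_) eq) (⊞-∷ʳ y x g h) ,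
    slice-⊞ {h = g} {h} (latticePt⇒slice y g lat) sl

  -- (w , k) is the average of the points of the 2k + 1 sets and of (0 , −1), multiplied by k + 1.
  IDP⇒halving : IDP (ΩGen G₁ G₂) → Halving (Stable G₁)
  IDP⇒halving idp k w (Ws , len , stable , total≡) with idp (suc k) (map +_ w ∷ʳ + k) inΩ
    where
    ps = List.map (point (+ 1) (+ 1)) Ws ++ List.map (point (ℤ.- (+ 1)) (ℤ.- (+ 1))) (∅ ∷ [])
    Ωps : All (ΩGen G₁ G₂) ps
    Ωps = All.++⁺ (All.map⁺ (All.map (λ {W} st → point⇒Ω G₁ G₂ (inj₁ (W , st , refl))) stable))
      (point⇒Ω G₁ G₂ (inj₂ (∅ , Stable-∅ G₂ , refl)) ∷ [])
    length≡ : length ps ≡ suc k + suc k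
    length≡ = trans (length-++ (List.map (point (+ 1) (+ 1)) Ws))
      (trans (cong (λ l → l + 1) (trans (length-map _ Ws) len)) (count k))
      where
      count : ∀ k → suc (k + k) + 1 ≡ suc k + suc k
      count = solve-∀
    coords : ∀ {d} (w : Weight d) → map (+ 1 ℤ.*_) ((w ⊕ w) ⊟ (𝟙 ∅ ⊕ 𝟎)) ≡ map +_ w ⊞ map +_ w
    coords []      = refl
    coords (n ∷ w) = cong₂ _∷_ (eq (+ n)) (coords w)
      where
      eq : ∀ n → + 1 ℤ.* (n ℤ.+ n ℤ.- + 0) ≡ n ℤ.+ n
      eq = solveℤ
    height : + 1 ℤ.* (+ length Ws ℤ.- + 1) ≡ + k ℤ.+ + k
    height = trans (cong (λ l → + 1 ℤ.* (+ l ℤ.- + 1)) len) (eq (+ k))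
      where
      eq : ∀ k → + 1 ℤ.* (+ 1 ℤ.+ (k ℤ.+ k) ℤ.- + 1) ≡ k ℤ.+ k
      eq = solveℤ
    inΩ : InConv (ΩGen G₁ G₂) ((map +_ w ∷ʳ + k) ÷suc k)
    inΩ = average-of-doubles∈conv (map +_ w ∷ʳ + k) ps Ωps length≡
      (trans (sum-signed-points (+ 1) (+ 1) Ws (∅ ∷ []))
        (trans (cong₂ _∷ʳ_ (trans (cong (λ u → map (+ 1 ℤ.*_) (u ⊟ (𝟙 ∅ ⊕ 𝟎))) total≡) (coords w)) height)
          (sym (⊞-∷ʳ (map +_ w) (map +_ w) (+ k) (+ k)))))
  ... | as , lats , a≡ with slice-sum as lats
  ... | x , h , sum≡ , δ , h+δ , f with Vec.∷ʳ-injective (map +_ w) x (trans a≡ sum≡)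
  -- The k + 1 lattice points reach total height `k`, so the shortfall is 1: one of them is the
  -- origin and the other `k` are stable sets at height 1.
  ... | refl , refl with +-cancelˡ-≡ k δ 1 (trans (ℤ.+-injective h+δ) (sym (+-comm k 1)))
  ... | refl with f ≤-refl
  ... | m , w′ , m+1 , w≡ , Dw′ = subst₂ D (+-cancelʳ-≡ 1 m k (trans m+1 (sym (+-comm k 1)))) (sym (map-+-injective w≡)) Dw′

-- Negation exchanges the two graphs

neg-/ : ∀ a k → ℤ.- a ℚ./ suc k ≡ ℚ.- (a ℚ./ suc k)
neg-/ (+ zero)  k = trans (/-≡ (+ 0) (+ 0) k 0 refl) (cong ℚ.-_ (/-≡ (+ 0) (+ 0) 0 k refl))
neg-/ (+ suc n) k = refl
neg-/ -[1+ n ]  k = sym (⁻¹-involutive _)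
  where open GroupProperties ℚ.+-0-group using (⁻¹-involutive)

negᵛ : Vec ℤ N → Vec ℤ N
negᵛ = map (ℤ.-_)

negℚᵛ : Vec ℚ N → Vec ℚ N
negℚᵛ = map (ℚ.-_)

negᵛ-÷ : (z : Vec ℤ N) (k : ℕ) → negᵛ z ÷suc k ≡ negℚᵛ (z ÷suc k)
negᵛ-÷ []      k = refl
negᵛ-÷ (a ∷ z) k = cong₂ _∷_ (neg-/ a k) (negᵛ-÷ z k)

combo-neg : ∀ {k} (ls : Vec ℚ k) (ps : Vec (Vec ℤ N) k) → combo ls (map negᵛ ps) ≡ negℚᵛ (combo ls ps)
combo-neg [] [] = zeros _
  where
  zeros : ∀ N → 0ᵛ {N} ≡ negℚᵛ 0ᵛ
  zeros zero    = refl
  zeros (suc N) = cong (0ℚ ∷_) (zeros N)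
combo-neg (l ∷ ls) (p ∷ ps) = trans (cong₂ (λ x y → (l ·ᵛ x) +ᵛ y) (negᵛ-÷ p 0) (combo-neg ls ps)) (eq (toℚ p) (combo ls ps))
  where
  eq : ∀ {N} (x y : Vec ℚ N) → (l ·ᵛ negℚᵛ x) +ᵛ negℚᵛ y ≡ negℚᵛ ((l ·ᵛ x) +ᵛ y)
  eq []      []      = refl
  eq (a ∷ x) (b ∷ y) = cong₂ _∷_
    (trans (cong (ℚ._+ ℚ.- b) (sym (ℚ.neg-distribʳ-* l a))) (sym (ℚ.neg-distrib-+ (l ℚ.* a) b))) (eq x y)

InConv-neg : {V V′ : Vec ℤ N → Set} → (∀ p → V p → V′ (negᵛ p)) → ∀ z k →
  InConv V (z ÷suc k) → InConv V′ (negᵛ z ÷suc k)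
InConv-neg V⇒V′ z k (l , ps , ls , Vps , ls≥0 , Σls≡1 , z≡) =
  l , map negᵛ ps , ls , Vecᴬ.map⁺ (Vecᴬ.map (V⇒V′ _) Vps) , ls≥0 , Σls≡1 ,
  trans (negᵛ-÷ z k) (trans (cong (negℚᵛ) z≡) (sym (combo-neg ls ps)))

negᵛ-involutive : (z : Vec ℤ N) → negᵛ (negᵛ z) ≡ z
negᵛ-involutive z = trans (sym (Vec.map-∘ (ℤ.-_) (ℤ.-_) z)) (trans (Vec.map-cong ℤ.neg-involutive z) (Vec.map-id z))

Ω-neg : (G₁ G₂ : SimpleGraph d) → ∀ p → ΩGen G₁ G₂ p → ΩGen G₂ G₁ (negᵛ p)
Ω-neg G₁ G₂ _ (inj₁ (W , st , refl)) = inj₂ (W , st , Vec.map-∷ʳ (ℤ.-_) (+ 1) (ρ W))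
Ω-neg G₁ G₂ _ (inj₂ (W , st , refl)) = inj₁ (W , st ,
  trans (Vec.map-∷ʳ (ℤ.-_) (ℤ.- (+ 1)) (negᵛ (ρ W))) (cong (_∷ʳ + 1) (negᵛ-involutive (ρ W))))

-- Negation is a lattice automorphism carrying one polytope onto the other, so it transports
-- decompositions.
IDP-swap : (G₁ G₂ : SimpleGraph d) → IDP (ΩGen G₁ G₂) → IDP (ΩGen G₂ G₁)
IDP-swap G₁ G₂ idp (suc k) a conv with idp (suc k) (negᵛ a) (InConv-neg (Ω-neg G₂ G₁) a k conv)
... | as , lats , eq = map negᵛ as , Vecᴬ.map⁺ (Vecᴬ.map (InConv-neg (Ω-neg G₁ G₂) _ 0) lats) ,
  trans (sym (negᵛ-involutive a)) (trans (cong negᵛ eq) (sym (sum-neg as)))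
  where
  ⊞-neg : ∀ {N} (x y : Vec ℤ N) → negᵛ x ⊞ negᵛ y ≡ negᵛ (x ⊞ y)
  ⊞-neg []      []      = refl
  ⊞-neg (a ∷ x) (b ∷ y) = cong₂ _∷_ (sym (ℤ.neg-distrib-+ a b)) (⊞-neg x y)
  zeros : ∀ N → Vec.replicate N (+ 0) ≡ negᵛ (Vec.replicate N (+ 0))
  zeros zero    = refl
  zeros (suc N) = cong (+ 0 ∷_) (zeros N)
  sum-neg : ∀ {N n} (as : Vec (Vec ℤ N) n) → Vec.foldr _ (zipWith ℤ._+_) (Vec.replicate _ (+ 0)) (map negᵛ as) ≡
    negᵛ (Vec.foldr _ (zipWith ℤ._+_) (Vec.replicate _ (+ 0)) as)
  sum-neg []       = zeros _
  sum-neg (a ∷ as) = trans (cong (negᵛ a ⊞_) (sum-neg as)) (⊞-neg a _)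

-- The equivalence of the three conditions

IDP⇒perfect : (G₁ G₂ : SimpleGraph d) → IDP (ΩGen G₁ G₂) → Perfect G₁ × Perfect G₂
IDP⇒perfect G₁ G₂ idp =
  halving⇒perfect G₁ (IDP⇒halving G₁ G₂ idp) , halving⇒perfect G₂ (IDP⇒halving G₂ G₁ (IDP-swap G₁ G₂ idp))

perfect⇒IDP : (G₁ G₂ : SimpleGraph d) → Perfect G₁ → Perfect G₂ → IDP (ΩGen G₁ G₂)
perfect⇒IDP G₁ G₂ perfect₁ perfect₂ =
  weightedPerfect⇒IDP G₁ G₂ (perfect⇒weightedPerfect G₁ perfect₁) (perfect⇒weightedPerfect G₂ perfect₂)

theorem1p1 : (d : ℕ) (G₁ G₂ : SimpleGraph d) →
    (IDP (ΩGen G₁ G₂) ⇔ (Reflexive (ΩGen G₁ G₂) × IDP (ΩGen G₁ G₂))) ×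
    ((Reflexive (ΩGen G₁ G₂) × IDP (ΩGen G₁ G₂)) ⇔ (Perfect G₁ × Perfect G₂))
theorem1p1 d G₁ G₂ =
  mk⇔ (λ idp → let perfect₁ , perfect₂ = IDP⇒perfect G₁ G₂ idp in perfect⇒reflexive G₁ G₂ perfect₁ perfect₂ , idp) proj₂ ,
  mk⇔ (IDP⇒perfect G₁ G₂ ∘ proj₂)
    λ (perfect₁ , perfect₂) → perfect⇒reflexive G₁ G₂ perfect₁ perfect₂ , perfect⇒IDP G₁ G₂ perfect₁ perfect₂
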